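{- Let $G$ be a weighted graph. Let $F$ be a bipartite graph and let $\mathcal{H}$ be the class of all graphs that are weighted cross-bipartite swapping in $G$. Then every $\mathcal{H}$-blow-up $H$ of $F$ is bipartite swapping in $G$, i.e. $\hom(H,G)^2\le\hom(H\times K_2,G)$.
   Context: A weighted graph $G$ is a symmetric function $G:V(G)\times V(G)\to\mathbb{R}_{\ge0}$ on a finite set (loops allowed). For a graph $H$, $\hom(H,G)=\sum_{\phi:V(H)\to V(G)}\prod_{uv\in E(H)}G(\phi(u),\phi(v))$. The tensor product $H\times K_2$ has vertex set $V(H)\times\{1,2\}$ with $(u,i)\sim(v,j)$ iff $uv\in E(H)$ and $i\ne j$. A graph $H$ is weighted cross-bipartite swapping in $G$ if for all $\mathbf{a},\mathbf{b}:V(G)\to\mathbb{R}_{\ge0}$, \[\Big(\sum_{\phi:V(H)\to V(G)}\prod_{uv\in E(H)}G(\phi(u),\phi(v))\prod_{u}a_{\phi(u)}\Big)\Big(\sum_{\phi:V(H)\to V(G)}\prod_{uv\in E(H)}G(\phi(u),\phi(v))\prod_{u}b_{\phi(u)}\Big)\le \sum_{\psi:V(H)\times\{1,2\}\to V(G)}\prod_{xy\in E(H\times K_2)}G(\psi(x),\psi(y))\prod_{u\in V(H)}a_{\psi(u,1)}b_{\psi(u,2)}.\] For a class $\mathcal{H}$ and a graph $F$ on vertices $v_1,\dots,v_k$, an $\mathcal{H}$-blow-up of $F$ is obtained by choosing $H_1,\dots,H_k\in\mathcal{H}$, taking their disjoint union, and adding all edges between $V(H_i)$ and $V(H_j)$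 whenever $v_iv_j\in E(F)$. -}

module Defs where

open import Algebra.Bundles.Raw using (RawSemiring)
import Algebra.Definitions.RawSemiring as RawSemiringDefs
open import Data.Bool.Base using (if_then_else_)
open import Data.Fin.Base as Fin using (Fin; finToFun; combine; remQuot)
open import Data.Fin.Patterns using (0F; 1F)
import Data.Fin.Properties as Fin
open import Data.Nat.Base as ℕ using (ℕ)
import Data.Nat.Properties as ℕ
open import Data.Product.Base using (Σ; ∃-syntax; _×_; _,_; proj₁; proj₂)
open import Data.Rational.Base as ℚ using (ℚ; 0ℚ; 1ℚ; ∣_∣)
import Data.Rational.Properties as ℚ
open import Data.Rational.Solver using (module +-*-Solver)
open import Function.Base using (_∘_)
open import Function.Bundles using (_⇔_; _↔_; module Inverse)
open import Level using (0ℓ)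
open import Relation.Binary.Core using (Rel)
open import Relation.Binary.Definitions using (Decidable; Symmetric; Irreflexive)
open import Relation.Binary.PropositionalEquality
open import Relation.Nullary.Decidable using (does; ¬?; _×-dec_)
open import Relation.Unary using (Pred; _∈_)

------------------------------------------------------------------------
-- Real numbers: Cauchy sequences of rationals, compared up to null
-- sequences.  The moduli of convergence are part of the data (Σ-types),
-- so no choice principle is involved.

IsCauchy : (ℕ → ℚ) → Set
IsCauchy s = ∀ ε → 0ℚ ℚ.< ε →
  ∃[ N ] ∀ m n → N ℕ.≤ m → N ℕ.≤ n → ∣ s m ℚ.- s n ∣ ℚ.≤ ε

record ℝ : Set where
  constructor mkℝ
  field
    seq    : ℕ → ℚ
    cauchy : IsCauchy seq

open ℝ public

infix 4 _≈_ _≤_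

_≈_ : Rel ℝ 0ℓ
x ≈ y = ∀ ε → 0ℚ ℚ.< ε →
  ∃[ N ] ∀ n → N ℕ.≤ n → ∣ seq x n ℚ.- seq y n ∣ ℚ.≤ ε

_≤_ : Rel ℝ 0ℓ
x ≤ y = ∀ ε → 0ℚ ℚ.< ε →
  ∃[ N ] ∀ n → N ℕ.≤ n → seq x n ℚ.≤ seq y n ℚ.+ ε

private
  module _ where
    open +-*-Solver

    distrib-ε : ∀ b c e i → b ℚ.* (e ℚ.* i) ℚ.+ c ℚ.* (e ℚ.* i) ≡ e ℚ.* ((b ℚ.+ c) ℚ.* i)
    distrib-ε = solve 4 (λ b c e i → b :* (e :* i) :+ c :* (e :* i) := e :* ((b :+ c) :* i)) refl

    insert : ∀ p q → p ≡ (p ℚ.- q) ℚ.+ q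
    insert = solve 2 (λ p q → p := (p :- q) :+ q) refl

    +-difference : ∀ p q r s → (p ℚ.+ q) ℚ.- (r ℚ.+ s) ≡ (p ℚ.- r) ℚ.+ (q ℚ.- s)
    +-difference = solve 4 (λ p q r s → (p :+ q) :- (r :+ s) := (p :- r) :+ (q :- s)) refl

    *-difference : ∀ p q r s → p ℚ.* q ℚ.- r ℚ.* s ≡ p ℚ.* (q ℚ.- s) ℚ.+ s ℚ.* (p ℚ.- r)
    *-difference = solve 4 (λ p q r s → p :* q :- r :* s := p :* (q :- s) :+ s :* (p :- r)) refl

abstract

  -- δ = ε / (b + c)
  split-ε : ∀ b c ε → 0ℚ ℚ.< b → 0ℚ ℚ.< c → 0ℚ ℚ.< ε →
            ∃[ δ ] (0ℚ ℚ.< δ × b ℚ.* δ ℚ.+ c ℚ.* δ ≡ ε)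
  split-ε b c ε 0<b 0<c 0<ε = helper (b ℚ.+ c) refl (ℚ.positive (ℚ.+-mono-< 0<b 0<c)) (ℚ.positive 0<ε)
    where
    helper : ∀ d → d ≡ b ℚ.+ c → ℚ.Positive d → ℚ.Positive ε →
             ∃[ δ ] (0ℚ ℚ.< δ × b ℚ.* δ ℚ.+ c ℚ.* δ ≡ ε)
    helper d d≡ d>0 ε>0 = ε ℚ.* d⁻¹ ,
      ℚ.positive⁻¹ (ε ℚ.* d⁻¹) {{ℚ.pos*pos⇒pos ε {{ε>0}} d⁻¹ {{ℚ.1/pos⇒pos d {{d>0}}}}}} ,
      (begin
        b ℚ.* (ε ℚ.* d⁻¹) ℚ.+ c ℚ.* (ε ℚ.* d⁻¹)  ≡⟨ distrib-ε b c ε d⁻¹ ⟩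
        ε ℚ.* ((b ℚ.+ c) ℚ.* d⁻¹)  ≡⟨ cong (λ z → ε ℚ.* (z ℚ.* d⁻¹)) d≡ ⟨
        ε ℚ.* (d ℚ.* d⁻¹)          ≡⟨ cong (ε ℚ.*_) (ℚ.*-inverseʳ d {{ℚ.pos⇒nonZero d {{d>0}}}}) ⟩
        ε ℚ.* 1ℚ                   ≡⟨ ℚ.*-identityʳ ε ⟩
        ε                          ∎)
      where
      open ≡-Reasoning
      d⁻¹ : ℚ
      d⁻¹ = (ℚ.1/ d) {{ℚ.pos⇒nonZero d {{d>0}}}}

  -- δ = ε / 2
  half-ε : ∀ ε → 0ℚ ℚ.< ε → ∃[ δ ] (0ℚ ℚ.< δ × δ ℚ.+ δ ≡ ε)
  half-ε ε 0<ε = helper 1ℚ (ℚ.positive⁻¹ 1ℚ) ℚ.*-identityˡ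
    where
    helper : ∀ u → 0ℚ ℚ.< u → (∀ p → u ℚ.* p ≡ p) → ∃[ δ ] (0ℚ ℚ.< δ × δ ℚ.+ δ ≡ ε)
    helper u 0<u u* = let δ , 0<δ , eq = split-ε u u ε 0<u 0<u 0<ε in
      δ , 0<δ , trans (sym (cong₂ ℚ._+_ (u* δ) (u* δ))) eq

  eventually-bounded : ∀ s → IsCauchy s →
    ∃[ N ] ∃[ b ] (0ℚ ℚ.< b × ∀ n → N ℕ.≤ n → ∣ s n ∣ ℚ.≤ b)
  eventually-bounded s c =
    let N , cN = c 1ℚ (ℚ.positive⁻¹ 1ℚ) in
    N , 1ℚ ℚ.+ ∣ s N ∣ ,
    ℚ.+-mono-<-≤ {0ℚ} {1ℚ} {0ℚ} {∣ s N ∣} (ℚ.positive⁻¹ 1ℚ) (ℚ.0≤∣p∣ (s N)) ,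
    λ n N≤n → begin
      ∣ s n ∣                      ≡⟨ cong ∣_∣ (insert (s n) (s N)) ⟩
      ∣ (s n ℚ.- s N) ℚ.+ s N ∣    ≤⟨ ℚ.∣p+q∣≤∣p∣+∣q∣ (s n ℚ.- s N) (s N) ⟩
      ∣ s n ℚ.- s N ∣ ℚ.+ ∣ s N ∣  ≤⟨ ℚ.+-monoˡ-≤ ∣ s N ∣ (cN n N N≤n ℕ.≤-refl) ⟩
      1ℚ ℚ.+ ∣ s N ∣               ∎
    where open ℚ.≤-Reasoning

  *-mono-∣∣ : ∀ p q b d → ∣ p ∣ ℚ.≤ b → ∣ q ∣ ℚ.≤ d → 0ℚ ℚ.< b →
              ∣ p ℚ.* q ∣ ℚ.≤ b ℚ.* d
  *-mono-∣∣ p q b d p≤b q≤d 0<b = begin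
    ∣ p ℚ.* q ∣      ≡⟨ ℚ.∣p*q∣≡∣p∣*∣q∣ p q ⟩
    ∣ p ∣ ℚ.* ∣ q ∣  ≤⟨ ℚ.*-monoʳ-≤-nonNeg ∣ q ∣ {{ℚ.nonNegative (ℚ.0≤∣p∣ q)}} p≤b ⟩
    b ℚ.* ∣ q ∣      ≤⟨ ℚ.*-monoˡ-≤-nonNeg b {{ℚ.nonNegative (ℚ.<⇒≤ 0<b)}} q≤d ⟩
    b ℚ.* d          ∎
    where open ℚ.≤-Reasoning

  const-cauchy : ∀ q → IsCauchy (λ _ → q)
  const-cauchy q ε 0<ε = 0 , λ _ _ _ _ →
    subst (ℚ._≤ ε) (sym (cong ∣_∣ (ℚ.+-inverseʳ q))) (ℚ.<⇒≤ 0<ε)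

  +-cauchy : ∀ s t → IsCauchy s → IsCauchy t → IsCauchy (λ n → s n ℚ.+ t n)
  +-cauchy s t cs ct ε 0<ε =
    let δ , 0<δ , eq = half-ε ε 0<ε
        M , cM = cs δ 0<δ
        N , cN = ct δ 0<δ
    in M ℕ.⊔ N , λ m n m≥ n≥ → begin
      ∣ (s m ℚ.+ t m) ℚ.- (s n ℚ.+ t n) ∣
        ≡⟨ cong ∣_∣ (+-difference (s m) (t m) (s n) (t n)) ⟩
      ∣ (s m ℚ.- s n) ℚ.+ (t m ℚ.- t n) ∣
        ≤⟨ ℚ.∣p+q∣≤∣p∣+∣q∣ (s m ℚ.- s n) (t m ℚ.- t n) ⟩
      ∣ s m ℚ.- s n ∣ ℚ.+ ∣ t m ℚ.- t n ∣
        ≤⟨ ℚ.+-mono-≤ (cM m n (ℕ.m⊔n≤o⇒m≤o M N m≥) (ℕ.m⊔n≤o⇒m≤o M N n≥))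
                      (cN m n (ℕ.m⊔n≤o⇒n≤o M N m≥) (ℕ.m⊔n≤o⇒n≤o M N n≥)) ⟩
      δ ℚ.+ δ
        ≡⟨ eq ⟩
      ε ∎
    where open ℚ.≤-Reasoning

  *-cauchy : ∀ s t → IsCauchy s → IsCauchy t → IsCauchy (λ n → s n ℚ.* t n)
  *-cauchy s t cs ct ε 0<ε =
    let K , b , 0<b , s≤b = eventually-bounded s cs
        L , c , 0<c , t≤c = eventually-bounded t ct
        δ , 0<δ , eq = split-ε b c ε 0<b 0<c 0<ε
        M , cM = cs δ 0<δ
        N , cN = ct δ 0<δ
    in (K ℕ.⊔ L) ℕ.⊔ (M ℕ.⊔ N) , λ m n m≥ n≥ →
    let KL≤m = ℕ.m⊔n≤o⇒m≤o (K ℕ.⊔ L) (M ℕ.⊔ N) m≥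
        KL≤n = ℕ.m⊔n≤o⇒m≤o (K ℕ.⊔ L) (M ℕ.⊔ N) n≥
        MN≤m = ℕ.m⊔n≤o⇒n≤o (K ℕ.⊔ L) (M ℕ.⊔ N) m≥
        MN≤n = ℕ.m⊔n≤o⇒n≤o (K ℕ.⊔ L) (M ℕ.⊔ N) n≥
    in begin
      ∣ s m ℚ.* t m ℚ.- s n ℚ.* t n ∣
        ≡⟨ cong ∣_∣ (*-difference (s m) (t m) (s n) (t n)) ⟩
      ∣ s m ℚ.* (t m ℚ.- t n) ℚ.+ t n ℚ.* (s m ℚ.- s n) ∣
        ≤⟨ ℚ.∣p+q∣≤∣p∣+∣q∣ (s m ℚ.* (t m ℚ.- t n)) (t n ℚ.* (s m ℚ.- s n)) ⟩
      ∣ s m ℚ.* (t m ℚ.- t n) ∣ ℚ.+ ∣ t n ℚ.* (s m ℚ.- s n) ∣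
        ≤⟨ ℚ.+-mono-≤
             (*-mono-∣∣ (s m) (t m ℚ.- t n) b δ (s≤b m (ℕ.m⊔n≤o⇒m≤o K L KL≤m))
               (cN m n (ℕ.m⊔n≤o⇒n≤o M N MN≤m) (ℕ.m⊔n≤o⇒n≤o M N MN≤n)) 0<b)
             (*-mono-∣∣ (t n) (s m ℚ.- s n) c δ (t≤c n (ℕ.m⊔n≤o⇒n≤o K L KL≤n))
               (cM m n (ℕ.m⊔n≤o⇒m≤o M N MN≤m) (ℕ.m⊔n≤o⇒m≤o M N MN≤n)) 0<c) ⟩
      b ℚ.* δ ℚ.+ c ℚ.* δ
        ≡⟨ eq ⟩
      ε ∎
    where open ℚ.≤-Reasoning

0ℝ 1ℝ : ℝ
0ℝ = mkℝ (λ _ → 0ℚ) (const-cauchy 0ℚ)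
1ℝ = mkℝ (λ _ → 1ℚ) (const-cauchy 1ℚ)

infixl 6 _+_
infixl 7 _*_

_+_ : ℝ → ℝ → ℝ
x + y = mkℝ (λ n → seq x n ℚ.+ seq y n) (+-cauchy (seq x) (seq y) (cauchy x) (cauchy y))

_*_ : ℝ → ℝ → ℝ
x * y = mkℝ (λ n → seq x n ℚ.* seq y n) (*-cauchy (seq x) (seq y) (cauchy x) (cauchy y))

ℝ-rawSemiring : RawSemiring 0ℓ 0ℓ
ℝ-rawSemiring = record
  { Carrier = ℝ ; _≈_ = _≈_ ; _+_ = _+_ ; _*_ = _*_ ; 0# = 0ℝ ; 1# = 1ℝ }

-- Finite sums and products over Fin n.
open RawSemiringDefs ℝ-rawSemiring public
  using () renaming (sum to ∑; product to ∏)

-- Sum over all maps Fin n → Fin m; finToFun enumerates each map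
-- exactly once.
∑Maps : ∀ {n m} → ((Fin n → Fin m) → ℝ) → ℝ
∑Maps {n} {m} f = ∑ {m ℕ.^ n} (λ i → f (finToFun i))

------------------------------------------------------------------------
-- Graphs.  Vertex sets are Fin n; this loses nothing, as every notion
-- below is invariant under relabelling.

-- Finite simple graphs.
record Graph : Set₁ where
  field
    order  : ℕ
    Adj    : Rel (Fin order) 0ℓ
    adj?   : Decidable Adj
    symm   : Symmetric Adj
    irrefl : Irreflexive _≡_ Adj

  Vertex : Set
  Vertex = Fin order

open Graph public using (Vertex)

record WeightedGraph : Set where
  field
    order    : ℕ
    weight   : Fin order → Fin order → ℝ
    symm     : ∀ x y → weight x y ≈ weight y x
    nonneg   : ∀ x y → 0ℝ ≤ weight x y

  Point : Set
  Point = Fin order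

open WeightedGraph public using (Point)

Bipartite : Graph → Set
Bipartite F = Σ (Vertex F → Fin 2) λ side →
  ∀ {u v} → Graph.Adj F u v → side u ≢ side v

-- The product over the edges uv of H of G(φ(u), φ(v)).  Each unordered
-- edge is counted once, through its orientation u < v; non-edges
-- contribute the factor 1.
∏Edges : (H : Graph) (G : WeightedGraph) → (Vertex H → Point G) → ℝ
∏Edges H G φ = ∏ λ u → ∏ λ v →
  if does ((u Fin.<? v) ×-dec Graph.adj? H u v)
  then WeightedGraph.weight G (φ u) (φ v)
  else 1ℝ

hom : Graph → WeightedGraph → ℝ
hom H G = ∑Maps {Graph.order H} {WeightedGraph.order G} (∏Edges H G)

-- The pair (u , i) is encoded as combine u i, whose inverse is remQuot 2;
-- the two layers 1, 2 are 0F, 1F.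
_×K₂ : Graph → Graph
H ×K₂ = record
  { order  = Graph.order H ℕ.* 2
  ; Adj    = λ x y → Graph.Adj H (base x) (base y) × layer x ≢ layer y
  ; adj?   = λ x y → Graph.adj? H (base x) (base y) ×-dec ¬? (layer x Fin.≟ layer y)
  ; symm   = λ (uv , i≢j) → Graph.symm H uv , i≢j ∘ sym
  ; irrefl = λ x≡y (_ , i≢j) → i≢j (cong layer x≡y)
  }
  where
  base : Fin (Graph.order H ℕ.* 2) → Vertex H
  base x = proj₁ (remQuot 2 x)

  layer : Fin (Graph.order H ℕ.* 2) → Fin 2
  layer x = proj₂ (remQuot {Graph.order H} 2 x)

BipartiteSwapping : WeightedGraph → Graph → Set
BipartiteSwapping G H = hom H G * hom H G ≤ hom (H ×K₂) G

WeightedCrossBipartiteSwapping : WeightedGraph → Pred Graph 0ℓ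
WeightedCrossBipartiteSwapping G H =
  (a b : Point G → ℝ) → (∀ x → 0ℝ ≤ a x) → (∀ x → 0ℝ ≤ b x) →
    (∑Maps λ φ → ∏Edges H G φ * ∏ λ u → a (φ u)) *
    (∑Maps λ φ → ∏Edges H G φ * ∏ λ u → b (φ u))
  ≤ (∑Maps λ ψ → ∏Edges (H ×K₂) G ψ *
       ∏ λ (u : Vertex H) → a (ψ (combine u 0F)) * b (ψ (combine u 1F)))

------------------------------------------------------------------------
-- Blow-ups

module _ (F : Graph) (parts : Vertex F → Graph) where

  BlowUpVertex : Set
  BlowUpVertex = Σ (Vertex F) λ i → Vertex (parts i)

  data BlowUpAdj : Rel BlowUpVertex 0ℓ where
    within  : ∀ {i u v} → Graph.Adj (parts i) u v → BlowUpAdj (i , u) (i , v)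
    between : ∀ {i j u v} → Graph.Adj F i j → BlowUpAdj (i , u) (j , v)

-- H is an 𝓗-blow-up of F, up to the labelling of its vertices by Fin.
record IsBlowUp (𝓗 : Pred Graph 0ℓ) (F H : Graph) : Set₁ where
  field
    parts   : Vertex F → Graph
    parts∈𝓗 : ∀ i → parts i ∈ 𝓗
    label   : Vertex H ↔ BlowUpVertex F parts
    adj⇔    : ∀ x y → Graph.Adj H x y ⇔
                BlowUpAdj F parts (Inverse.to label x) (Inverse.to label y)

{-# OPTIONS --safe #-}

module Submission where

-- In the parts Hᵢ lying on one side of the bipartite graph F, exchange the two
-- copies of Hᵢ in the disjoint union of two copies of H.  An edge between two
-- parts then joins different layers, so outside the parts the graph is already
-- H × K₂.  It remains to replace two copies of Hᵢ by Hᵢ × K₂, one part at a time.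
-- With the maps of the other parts fixed, the edges leaving Hᵢ contribute
-- c · ∏ᵤ a(ψ(u , 1)) b(ψ(u , 2)), where a and b are products of edge weights, so
-- each replacement is the weighted cross-bipartite swapping inequality of Hᵢ.

open import Algebra.Bundles using (CommutativeMonoid; CommutativeSemiring)
open import Data.Bool.Base using (Bool; true; false; if_then_else_; _∧_; _∨_; not)
open import Data.Bool.Properties using (∧-comm; ∧-zeroʳ)
open import Data.Fin.Base using (Fin; zero; suc; _<_; _↑ˡ_; _↑ʳ_; combine; remQuot; splitAt; finToFun; funToFin)
open import Data.Fin.Patterns using (0F; 1F)
open import Data.Fin.Permutation using (reverse)
open import Data.Fin.Properties
  using (_≟_; _<?_; <-cmp; <⇒≢; +↔⊎; *↔×; remQuot-combine; funToFin-finToFin; finToFun-funToFin; ∀-cons)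
open import Data.Nat.Base as ℕ using (ℕ; zero; suc)
import Data.Nat.Properties as ℕ
open import Data.Product.Base using (Σ; _×_; _,_; proj₁; proj₂; ∃-syntax)
open import Data.Product.Function.NonDependent.Propositional using (_×-↔_)
open import Data.Rational.Base as ℚ using (ℚ; 0ℚ; 1ℚ; ∣_∣)
import Data.Rational.Properties as ℚ
open import Data.Rational.Solver using (module +-*-Solver)
open import Data.Sum.Base using (_⊎_; inj₁; inj₂; [_,_]′)
open import Data.Sum.Function.Propositional using (_⊎-↔_)
open import Data.Vec.Functional using (foldr; _∷_; _++_)
open import Data.Vec.Functional.Properties using (lookup-++ˡ; lookup-++ʳ)
open import Defs using (Graph; Vertex; _×K₂)
open import Function.Base using (_∘_)
open import Function.Bundles using (_⇔_; _↔_; mk↔ₛ′; mk⇔; module Inverse; module Equivalence)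
open import Function.Construct.Composition using (_↔-∘_)
open import Function.Construct.Identity using (↔-id)
open import Function.Construct.Symmetry using (↔-sym)
open import Function.Related.TypeIsomorphisms using (Σ-assoc)
open import Level using (_⊔_; 0ℓ) renaming (suc to lsuc)
open import Relation.Binary.Bundles using (Preorder)
open import Relation.Binary.Core using (Rel)
open import Relation.Binary.Definitions using (tri<; tri≈; tri>)
open import Relation.Binary.PropositionalEquality as ≡ using (_≡_; _≢_; _≗_)
open import Relation.Binary.Structures using (IsPreorder)
open import Relation.Nullary.Decidable using (Dec; yes; no; does; _×-dec_; dec-true; dec-false; does-⇔)
open import Relation.Nullary.Negation using (contradiction)

open Inverse using (to; from; strictlyInverseˡ; strictlyInverseʳ)

-- The weighted hypothesis is what makes the replacement repeatable: with the other parts fixed, the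
-- edges leaving `Hᵢ` survive only as weights on its vertices. Two weight functions arise because
-- layer 0 of `Hᵢ` meets only layer 1 of its neighbours and layer 1 only layer 0. The factor of the
-- edges between parts (`interaction`) is the same before and after every replacement, so the
-- induction carries it along as a function `K` of which it asks only separability in each part. One
-- obstacle comes from the encoding: an edge product orients each edge by the numbering of `H`,
-- which is unrelated to the parts. Symmetry of the weights allows all edges to be reoriented by
-- parts (`lex`) before the product is factored.

-- Enumerations of disjoint unions and sums over them

total : ∀ {k} → (Fin k → ℕ) → ℕ
total = foldr ℕ._+_ 0

Σ-Fin-suc : ∀ {k} (A : Fin (suc k) → Set) → (A zero ⊎ Σ (Fin k) (A ∘ suc)) ↔ Σ (Fin (suc k)) A
Σ-Fin-suc A = mk↔ₛ′
  (λ { (inj₁ x) → zero , x ; (inj₂ (i , x)) → suc i , x })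
  (λ { (zero , x) → inj₁ x ; (suc i , x) → inj₂ (i , x) })
  (λ { (zero , x) → ≡.refl ; (suc i , x) → ≡.refl })
  (λ { (inj₁ x) → ≡.refl ; (inj₂ (i , x)) → ≡.refl })

enumerateΣ : ∀ {k} (n : Fin k → ℕ) → Fin (total n) ↔ Σ (Fin k) (Fin ∘ n)
enumerateΣ {zero}  n = mk↔ₛ′ (λ ()) (λ ()) (λ ()) (λ ())
enumerateΣ {suc k} n = Σ-Fin-suc (Fin ∘ n) ↔-∘ ((↔-id _ ⊎-↔ enumerateΣ (n ∘ suc)) ↔-∘ +↔⊎)

-- Stated for a commutative monoid because it is used twice: additively for sums over maps,
-- multiplicatively for products over edges.
module FiniteSums {c ℓ} (M : CommutativeMonoid c ℓ) where

  open CommutativeMonoid M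
  open import Algebra.Properties.CommutativeMonoid.Sum M
  open import Relation.Binary.Reasoning.Setoid setoid

  sum-ε : ∀ {n} (f : Fin n → Carrier) → (∀ i → f i ≈ ε) → sum f ≈ ε
  sum-ε {n} f f≈ε = trans (sum-cong-≋ f≈ε) (sum-replicate-zero n)

  sum-↑ : ∀ m {n} (f : Fin (m ℕ.+ n) → Carrier) →
          sum f ≈ sum (λ i → f (i ↑ˡ n)) ∙ sum (λ j → f (m ↑ʳ j))
  sum-↑ zero    f = sym (identityˡ _)
  sum-↑ (suc m) f = trans (∙-congˡ (sum-↑ m (f ∘ suc))) (sym (assoc _ _ _))

  sum-combine : ∀ m {n} (f : Fin (m ℕ.* n) → Carrier) →
                sum f ≈ sum λ i → sum λ j → f (combine {m} {n} i j)
  sum-combine zero        f = refl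
  sum-combine (suc m) {n} f = trans (sum-↑ n f) (∙-congˡ (sum-combine m (λ i → f (n ↑ʳ i))))

  sum-combine₂ : ∀ n (f : Fin (n ℕ.* 2) → Carrier) →
                 sum f ≈ sum λ (u : Fin n) → f (combine u 0F) ∙ f (combine u 1F)
  sum-combine₂ n f = trans (sum-combine n f) (sum-cong-≋ {n} λ u → ∙-congˡ (identityʳ _))

  sum-select : ∀ {n} (i : Fin n) (f : Fin n → Carrier) →
               sum (λ j → if does (i ≟ j) then f j else ε) ≈ f i
  sum-select {suc n} zero f = trans (∙-congˡ (sum-ε {n} (λ _ → ε) λ _ → refl)) (identityʳ _)
  sum-select (suc i) f = trans (identityˡ _) (sum-select i (f ∘ suc))

  private
    sum-enumerateΣ : ∀ {k} (n : Fin k → ℕ) (f : Fin (total n) → Carrier) →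
                     sum f ≈ sum λ i → sum λ u → f (from (enumerateΣ n) (i , u))
    sum-enumerateΣ {zero}  n f = refl
    sum-enumerateΣ {suc k} n f =
      trans (sum-↑ (n zero) f) (∙-congˡ (sum-enumerateΣ (n ∘ suc) (λ j → f (n zero ↑ʳ j))))

  -- An arbitrary labelling `e` differs from `enumerateΣ n` by a permutation of the indices, and a
  -- commutative sum does not see it.
  sum-Σ : ∀ {k N} (n : Fin k → ℕ) (e : Fin N ↔ Σ (Fin k) (Fin ∘ n)) (f : Fin N → Carrier) →
          sum f ≈ sum λ i → sum λ u → f (from e (i , u))
  sum-Σ n e f = begin
    sum f
      ≈⟨ sum-permute f (↔-sym e ↔-∘ enumerateΣ n) ⟩
    sum (f ∘ from e ∘ to (enumerateΣ n))
      ≈⟨ sum-enumerateΣ n _ ⟩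
    (sum λ i → sum λ u → f (from e (to (enumerateΣ n) (from (enumerateΣ n) (i , u)))))
      ≈⟨ sum-cong-≋ (λ i → sum-cong-≋ λ u →
           reflexive (≡.cong (f ∘ from e) (strictlyInverseˡ (enumerateΣ n) (i , u)))) ⟩
    (sum λ i → sum λ u → f (from e (i , u))) ∎

  sum₂-distrib-∙ : ∀ {m n} (f g : Fin m → Fin n → Carrier) →
    (sum λ i → sum λ j → f i j ∙ g i j) ≈ (sum λ i → sum (f i)) ∙ (sum λ i → sum (g i))
  sum₂-distrib-∙ f g =
    trans (sum-cong-≋ λ i → ∑-distrib-+ (f i) (g i)) (∑-distrib-+ (sum ∘ f) (sum ∘ g))

  -- Only the pairs on which the two orientations disagree matter, and these
  -- are exchanged by transposition.
  orientation-independent : ∀ {n} (adj O O′ : Fin n → Fin n → Bool) (f : Fin n → Fin n → Carrier) →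
    (∀ u v → adj u v ≡ adj v u) → (∀ u v → f u v ≈ f v u) →
    (∀ u v → adj u v ≡ true → O v u ≡ not (O u v)) →
    (∀ u v → adj u v ≡ true → O′ v u ≡ not (O′ u v)) →
    (sum λ u → sum λ v → if O u v ∧ adj u v then f u v else ε) ≈
    (sum λ u → sum λ v → if O′ u v ∧ adj u v then f u v else ε)
  orientation-independent {n} adj O O′ f adj-sym f-sym O-anti O′-anti = begin
    (sum λ u → sum λ v → if O u v ∧ adj u v then f u v else ε)
      ≈⟨ sum-cong-≋ (λ u → sum-cong-≋ λ v → split (O u v) (O′ u v) (adj u v) (f u v)) ⟩
    (sum λ u → sum λ v → both u v ∙ only O O′ u v)
      ≈⟨ sum₂-distrib-∙ both (only O O′) ⟩
    (sum λ u → sum (both u)) ∙ (sum λ u → sum (only O O′ u))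
      ≈⟨ ∙-congˡ (∑-comm (only O O′)) ⟩
    (sum λ u → sum (both u)) ∙ (sum λ v → sum λ u → only O O′ u v)
      ≈⟨ ∙-congˡ (sum-cong-≋ λ v → sum-cong-≋ λ u → transpose u v) ⟩
    (sum λ u → sum (both u)) ∙ (sum λ u → sum (only O′ O u))
      ≈⟨ sum₂-distrib-∙ both (only O′ O) ⟨
    (sum λ u → sum λ v → both u v ∙ only O′ O u v)
      ≈⟨ sum-cong-≋ (λ u → sum-cong-≋ λ v → split′ (O u v) (O′ u v) (adj u v) (f u v)) ⟨
    (sum λ u → sum λ v → if O′ u v ∧ adj u v then f u v else ε) ∎
    where
    both : Fin n → Fin n → Carrier
    both u v = if (O u v ∧ O′ u v) ∧ adj u v then f u v else ε

    only : (P Q : Fin n → Fin n → Bool) → Fin n → Fin n → Carrier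
    only P Q u v = if (P u v ∧ not (Q u v)) ∧ adj u v then f u v else ε

    split : ∀ p q a x → (if p ∧ a then x else ε) ≈
      (if (p ∧ q) ∧ a then x else ε) ∙ (if (p ∧ not q) ∧ a then x else ε)
    split false q     a x = sym (identityˡ _)
    split true  false a x = sym (identityˡ _)
    split true  true  a x = sym (identityʳ _)

    split′ : ∀ p q a x → (if q ∧ a then x else ε) ≈
      (if (p ∧ q) ∧ a then x else ε) ∙ (if (q ∧ not p) ∧ a then x else ε)
    split′ p q a x rewrite ∧-comm p q = split q p a x

    transpose : ∀ u v → only O O′ u v ≈ only O′ O v u
    transpose u v with adj u v in uv | adj v u in vu
    ... | true  | true  rewrite O-anti u v uv | O′-anti u v uv = flip (O u v) (O′ u v)
      where
      flip : ∀ p q → (if (p ∧ not q) ∧ true then f u v else ε) ≈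
                     (if (not q ∧ not (not p)) ∧ true then f v u else ε)
      flip false false = refl
      flip false true  = refl
      flip true  false = f-sym u v
      flip true  true  = refl
    ... | false | false
      rewrite ∧-zeroʳ (O u v ∧ not (O′ u v)) | ∧-zeroʳ (O′ v u ∧ not (O v u)) = refl
    ... | true  | false with () ← ≡.trans (≡.sym uv) (≡.trans (adj-sym u v) vu)
    ... | false | true  with () ← ≡.trans (≡.sym vu) (≡.trans (adj-sym v u) uv)

-- Sums over maps

funToFin-cong : ∀ {m n} {f g : Fin m → Fin n} → f ≗ g → funToFin f ≡ funToFin g
funToFin-cong {zero}  f≗g = ≡.refl
funToFin-cong {suc m} f≗g = ≡.cong₂ combine (f≗g zero) (funToFin-cong (f≗g ∘ suc))

-- Precomposition with a bijection, transported to the codes of maps, so that a change of variables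
-- in a sum over maps becomes a permutation of a finite sum.
reindexMaps : ∀ {m n n′} → Fin n ↔ Fin n′ → Fin (m ℕ.^ n) ↔ Fin (m ℕ.^ n′)
reindexMaps {m} {n} {n′} π = mk↔ₛ′
  (λ i → funToFin (finToFun {m} {n} i ∘ from π))
  (λ i → funToFin (finToFun {m} {n′} i ∘ to π))
  (λ i → ≡.trans
    (funToFin-cong λ x → ≡.trans (finToFun-funToFin (finToFun {m} {n′} i ∘ to π) (from π x))
                                 (≡.cong (finToFun i) (strictlyInverseˡ π x)))
    (funToFin-finToFin {n′} {m} i))
  (λ i → ≡.trans
    (funToFin-cong λ x → ≡.trans (finToFun-funToFin (finToFun {m} {n} i ∘ from π) (to π x))
                                 (≡.cong (finToFun i) (strictlyInverseʳ π x)))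
    (funToFin-finToFin {n} {m} i))

∷-++ : ∀ {a b m} (x : Fin m) (α : Fin a → Fin m) (β : Fin b → Fin m) →
       x ∷ (α ++ β) ≗ (x ∷ α) ++ β
∷-++ x α β zero = ≡.refl
∷-++ {a} x α β (suc i) with splitAt a i
... | inj₁ _ = ≡.refl
... | inj₂ _ = ≡.refl

++-congˡ : ∀ {a b m} {α α′ : Fin a → Fin m} (β : Fin b → Fin m) →
           α ≗ α′ → α ++ β ≗ α′ ++ β
++-congˡ {a} β α≗α′ i with splitAt a i
... | inj₁ j = α≗α′ j
... | inj₂ _ = ≡.refl

module MapSums {c ℓ} (R : CommutativeSemiring c ℓ) where

  open CommutativeSemiring R hiding (zero)
  open import Algebra.Properties.Semiring.Sum semiring
  open FiniteSums +-commutativeMonoid using (sum-combine)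
  open import Relation.Binary.Reasoning.Setoid setoid

  -- Decoding the code of a map returns it only up to pointwise equality, so every reindexing of a
  -- sum over maps needs a summand that respects `≗`.
  Extensional : ∀ {n m} → ((Fin n → Fin m) → Carrier) → Set ℓ
  Extensional f = ∀ {φ ψ} → φ ≗ ψ → f φ ≈ f ψ

  -- Opaque, so that the summand can be inferred from the sum.
  opaque
    sumMaps : ∀ {n m} → ((Fin n → Fin m) → Carrier) → Carrier
    sumMaps {n} {m} f = sum {m ℕ.^ n} (f ∘ finToFun)

    sumMaps-cong : ∀ {n m} {f g : (Fin n → Fin m) → Carrier} → (∀ φ → f φ ≈ g φ) → sumMaps f ≈ sumMaps g
    sumMaps-cong f≈g = sum-cong-≋ (f≈g ∘ finToFun)

    sumMaps-*ˡ : ∀ {n m} x (f : (Fin n → Fin m) → Carrier) →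
                 x * sumMaps f ≈ sumMaps (λ φ → x * f φ)
    sumMaps-*ˡ {n} {m} x f = *-distribˡ-sum {m ℕ.^ n} x (f ∘ finToFun)

    sumMaps-*ʳ : ∀ {n m} x (f : (Fin n → Fin m) → Carrier) →
                 sumMaps f * x ≈ sumMaps (λ φ → f φ * x)
    sumMaps-*ʳ {n} {m} x f = *-distribʳ-sum {m ℕ.^ n} x (f ∘ finToFun)

    sumMaps-comm : ∀ {n m n′ m′} (f : (Fin n → Fin m) → (Fin n′ → Fin m′) → Carrier) →
                   sumMaps (λ φ → sumMaps (f φ)) ≈ sumMaps (λ ψ → sumMaps λ φ → f φ ψ)
    sumMaps-comm f = ∑-comm (λ i j → f (finToFun i) (finToFun j))

  opaque
    unfolding sumMaps

    sumMaps-zero : ∀ {m} (f : (Fin 0 → Fin m) → Carrier) → sumMaps f ≈ f (finToFun 0F)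
    sumMaps-zero f = +-identityʳ _

    -- The code of a map on `suc n` points is `combine` of its value at `zero` and the code of its
    -- restriction to the other points.
    sumMaps-suc : ∀ {n m} (f : (Fin (suc n) → Fin m) → Carrier) → Extensional f →
                  sumMaps f ≈ sum λ x → sumMaps λ φ → f (x ∷ φ)
    sumMaps-suc {n} {m} f ext = trans (sum-combine m {m ℕ.^ n} (f ∘ finToFun))
      (sum-cong-≋ λ x → sum-cong-≋ {m ℕ.^ n} λ i → ext λ
        { zero    → ≡.cong proj₁ (remQuot-combine x i)
        ; (suc j) → ≡.cong (λ xi → finToFun {m} {n} (proj₂ xi) j) (remQuot-combine x i) })

  sumMaps-++ : ∀ a {b m} (f : (Fin (a ℕ.+ b) → Fin m) → Carrier) → Extensional f →
               sumMaps f ≈ sumMaps λ (α : Fin a → Fin m) → sumMaps λ (β : Fin b → Fin m) → f (α ++ β)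
  sumMaps-++ zero f ext = sym (sumMaps-zero _)
  sumMaps-++ (suc a) {b} {m} f ext = begin
    sumMaps f
      ≈⟨ sumMaps-suc f ext ⟩
    (sum λ x → sumMaps λ φ → f (x ∷ φ))
      ≈⟨ sum-cong-≋ {m} (λ x → sumMaps-++ a {b} (λ φ → f (x ∷ φ))
           λ φ≗ψ → ext λ { zero → ≡.refl ; (suc i) → φ≗ψ i }) ⟩
    (sum λ x → sumMaps λ (α : Fin a → Fin m) → sumMaps λ (β : Fin b → Fin m) → f (x ∷ (α ++ β)))
      ≈⟨ sum-cong-≋ {m} (λ x → sumMaps-cong λ α → sumMaps-cong λ β → ext (∷-++ x α β)) ⟩
    (sum λ x → sumMaps λ (α : Fin a → Fin m) → sumMaps λ (β : Fin b → Fin m) → f ((x ∷ α) ++ β))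
      ≈⟨ sumMaps-suc (λ α → sumMaps λ β → f (α ++ β))
           (λ φ≗ψ → sumMaps-cong λ β → ext (++-congˡ β φ≗ψ)) ⟨
    (sumMaps λ (α : Fin (suc a) → Fin m) → sumMaps λ (β : Fin b → Fin m) → f (α ++ β)) ∎

  opaque
    unfolding sumMaps

    sumMaps-permute : ∀ {n n′ m} (π : Fin n ↔ Fin n′) (f : (Fin n → Fin m) → Carrier) → Extensional f →
                      sumMaps f ≈ sumMaps λ φ → f (φ ∘ to π)
    sumMaps-permute {n} {n′} {m} π f ext = trans
      (sum-permute (f ∘ finToFun) (reindexMaps {m} (↔-sym π)))
      (sum-cong-≋ {m ℕ.^ n′} λ i → ext (finToFun-funToFin (finToFun {m} {n′} i ∘ to π)))

  sumMaps-⊎ : ∀ {n a b m} (e : Fin n ↔ (Fin a ⊎ Fin b)) (f : (Fin n → Fin m) → Carrier) → Extensional f →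
              sumMaps f ≈ sumMaps λ α → sumMaps λ β → f ([ α , β ]′ ∘ to e)
  sumMaps-⊎ {n} {a} {b} e f ext = trans (sumMaps-permute (↔-sym +↔⊎ ↔-∘ e) f ext)
    (trans (sumMaps-++ a (λ φ → f (φ ∘ to (↔-sym +↔⊎ ↔-∘ e))) (λ φ≗ψ → ext λ i → φ≗ψ _))
      (sumMaps-cong λ α → sumMaps-cong λ β → ext λ i →
        ≡.cong [ α , β ]′ (strictlyInverseˡ (+↔⊎ {a} {b}) (to e i))))

  Extensionalᵈ : ∀ {k m} {n : Fin k → ℕ} → ((∀ i → Fin (n i) → Fin m) → Carrier) → Set ℓ
  Extensionalᵈ f = ∀ {χ χ′} → (∀ i → χ i ≗ χ′ i) → f χ ≈ f χ′

  opaque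
    -- A family with one map per part is encoded as a single map on the disjoint union of the parts,
    -- so that sums over families inherit the laws of sums over maps.
    sumFamilies : ∀ {k m} (n : Fin k → ℕ) → ((∀ i → Fin (n i) → Fin m) → Carrier) → Carrier
    sumFamilies n f = sumMaps λ φ → f (λ i u → φ (from (enumerateΣ n) (i , u)))

    sumFamilies-cong : ∀ {k m} (n : Fin k → ℕ) {f g : (∀ i → Fin (n i) → Fin m) → Carrier} →
                       (∀ χ → f χ ≈ g χ) → sumFamilies n f ≈ sumFamilies n g
    sumFamilies-cong n f≈g = sumMaps-cong λ _ → f≈g _

    -- `enumerateΣ` lists the first part first, so splitting off its map is an instance of
    -- `sumMaps-++`. This is the inductive step of `swapAllParts`.
    sumFamilies-suc : ∀ {k m} (n : Fin (suc k) → ℕ) (f : (∀ i → Fin (n i) → Fin m) → Carrier) → Extensionalᵈ f →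
      sumFamilies n f ≈ sumMaps λ ξ → sumFamilies (n ∘ suc) λ χ → f (∀-cons ξ χ)
    sumFamilies-suc n f ext = trans
      (sumMaps-++ (n zero) _ λ φ≗ψ → ext λ i u → φ≗ψ _)
      (sumMaps-cong λ α → sumMaps-cong λ β → ext λ
        { zero    u → lookup-++ˡ α β u
        ; (suc i) u → lookup-++ʳ α β (from (enumerateΣ (n ∘ suc)) (i , u)) })

    sumFamilies-relabel : ∀ {k m N} (n : Fin k → ℕ) (e : Fin N ↔ Σ (Fin k) (Fin ∘ n))
      (f : (Fin N → Fin m) → Carrier) → Extensional f →
      sumMaps f ≈ sumFamilies n λ χ → f (λ x → χ (proj₁ (to e x)) (proj₂ (to e x)))
    sumFamilies-relabel n e f ext = sumMaps-permute (↔-sym (enumerateΣ n) ↔-∘ e) f ext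

    -- Meant for `twist`: it turns a sum over maps of the doubled parts into a double sum over maps
    -- of two copies of `H`.
    sumFamilies-⊎ : ∀ {k m a b} (n : Fin k → ℕ) (e : Σ (Fin k) (Fin ∘ n) ↔ (Fin a ⊎ Fin b))
      (f : (∀ i → Fin (n i) → Fin m) → Carrier) → Extensionalᵈ f →
      sumFamilies n f ≈ sumMaps λ α → sumMaps λ β → f (λ i u → [ α , β ]′ (to e (i , u)))
    sumFamilies-⊎ n e f ext = trans
      (sumMaps-⊎ (e ↔-∘ enumerateΣ n) _ λ φ≗ψ → ext λ i u → φ≗ψ _)
      (sumMaps-cong λ α → sumMaps-cong λ β → ext λ i u →
        ≡.cong ([ α , β ]′ ∘ to e) (strictlyInverseˡ (enumerateΣ n) (i , u)))

    sumFamilies-*ˡ : ∀ {k m} (n : Fin k → ℕ) x (f : (∀ i → Fin (n i) → Fin m) → Carrier) →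
                     x * sumFamilies n f ≈ sumFamilies n λ χ → x * f χ
    sumFamilies-*ˡ n x f = sumMaps-*ˡ x _

    sumMaps-sumFamilies-comm : ∀ {k m n′ m′} (n : Fin k → ℕ)
      (f : (Fin n′ → Fin m′) → (∀ i → Fin (n i) → Fin m) → Carrier) →
      sumMaps (λ φ → sumFamilies n (f φ)) ≈ sumFamilies n λ χ → sumMaps λ φ → f φ χ
    sumMaps-sumFamilies-comm n f = sumMaps-comm λ φ ψ → f φ λ i u → ψ (from (enumerateΣ n) (i , u))

-- Products over edges

does-true : ∀ {a} {A : Set a} (a? : Dec A) → does a? ≡ true → A
does-true (yes a) _ = a

<?-anti : ∀ {n} {u v : Fin n} → u ≢ v → does (v <? u) ≡ not (does (u <? v))
<?-anti {u = u} {v} u≢v with <-cmp u v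
... | tri< u<v _ v≮u rewrite dec-true (u <? v) u<v | dec-false (v <? u) v≮u = ≡.refl
... | tri≈ _ u≡v _ = contradiction u≡v u≢v
... | tri> u≮v _ v<u rewrite dec-false (u <? v) u≮v | dec-true (v <? u) v<u = ≡.refl

-- The orientation adapted to the parts: an edge between two parts points to the larger index, an
-- edge inside a part follows the order of that part.
lex : ∀ {k} {n : Fin k → ℕ} (p q : Σ (Fin k) (Fin ∘ n)) → Bool
lex (i , u) (j , v) = does (i <? j) ∨ (does (i ≟ j) ∧ does (u <? v))

lex-anti : ∀ {k} {n : Fin k → ℕ} {p q : Σ (Fin k) (Fin ∘ n)} → p ≢ q → lex q p ≡ not (lex p q)
lex-anti {p = i , u} {j , v} p≢q with <-cmp i j
... | tri< i<j i≢j j≮i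
  rewrite dec-true (i <? j) i<j | dec-false (j <? i) j≮i | dec-false (j ≟ i) (i≢j ∘ ≡.sym) = ≡.refl
... | tri> i≮j i≢j j<i
  rewrite dec-false (i <? j) i≮j | dec-true (j <? i) j<i | dec-false (i ≟ j) i≢j = ≡.refl
... | tri≈ i≮i ≡.refl _
  rewrite dec-false (i <? i) i≮i | dec-true (i ≟ i) ≡.refl = <?-anti {u = u} {v} λ { ≡.refl → p≢q ≡.refl }

-- Bijections that regroup the doubled vertex set

Σ-↔-fibrewise : ∀ {I : Set} {A B : I → Set} → (∀ i → A i ↔ B i) → Σ I A ↔ Σ I B
Σ-↔-fibrewise e = mk↔ₛ′
  (λ (i , x) → i , to (e i) x)
  (λ (i , y) → i , from (e i) y)
  (λ (i , y) → ≡.cong (i ,_) (strictlyInverseˡ (e i) y))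
  (λ (i , x) → ≡.cong (i ,_) (strictlyInverseʳ (e i) x))

×Fin2↔⊎ : ∀ {A : Set} → (A × Fin 2) ↔ (A ⊎ A)
×Fin2↔⊎ = mk↔ₛ′
  (λ { (x , 0F) → inj₁ x ; (x , 1F) → inj₂ x })
  (λ { (inj₁ x) → x , 0F ; (inj₂ x) → x , 1F })
  (λ { (inj₁ x) → ≡.refl ; (inj₂ x) → ≡.refl })
  (λ { (x , 0F) → ≡.refl ; (x , 1F) → ≡.refl })

shift : Fin 2 → Fin 2 ↔ Fin 2
shift 0F = ↔-id _
shift 1F = reverse

layer : ∀ {n} → Fin (n ℕ.* 2) → Fin 2
layer {n} p = proj₂ (remQuot {n} 2 p)

layer-combine : ∀ {n} (u : Fin n) l → layer {n} (combine u l) ≡ l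
layer-combine u l = ≡.cong proj₂ (remQuot-combine u l)

module _ {k N} (n : Fin k → ℕ) (label : Fin N ↔ Σ (Fin k) (Fin ∘ n)) where

  -- It presents `H ×K₂` as partitioned into the graphs `parts i ×K₂`, so that one factorization
  -- lemma serves both `H` and `H ×K₂`.
  doubledLabel : Fin (N ℕ.* 2) ↔ Σ (Fin k) (λ i → Fin (n i ℕ.* 2))
  doubledLabel = Σ-↔-fibrewise (λ i → ↔-sym *↔×) ↔-∘ (Σ-assoc ↔-∘ ((label ×-↔ ↔-id _) ↔-∘ *↔×))

  -- The vertex (u , l) of the i-th part is sent to the copy l + side i (mod 2) of u.
  twist : (Fin k → Fin 2) → Σ (Fin k) (λ i → Fin (n i ℕ.* 2)) ↔ (Fin N ⊎ Fin N)
  twist side = ×Fin2↔⊎ ↔-∘ ((↔-sym label ×-↔ ↔-id _) ↔-∘ (↔-sym Σ-assoc ↔-∘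
    Σ-↔-fibrewise λ i → (↔-id _ ×-↔ shift (side i)) ↔-∘ *↔×))

  to-twist : ∀ side i (u : Fin (n i)) l → to (twist side) (i , combine u l) ≡
             to ×Fin2↔⊎ (from label (i , u) , to (shift (side i)) l)
  to-twist side i u l = ≡.cong
    (λ (v , l′) → to ×Fin2↔⊎ (from label (i , v) , to (shift (side i)) l′)) (remQuot-combine u l)

adj?-×K₂ : ∀ H (x y : Vertex H) l l′ → does (Graph.adj? (H ×K₂) (combine x l) (combine y l′)) ≡
           does (Graph.adj? H x y) ∧ not (does (l ≟ l′))
adj?-×K₂ H x y l l′ = ≡.cong₂
  (λ (x , l) (y , l′) → does (Graph.adj? H x y) ∧ not (does (l ≟ l′)))
  (remQuot-combine x l) (remQuot-combine y l′)

module Edges {c ℓ} (R : CommutativeSemiring c ℓ) {m : ℕ}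
  (w : Fin m → Fin m → CommutativeSemiring.Carrier R) where

  open CommutativeSemiring R hiding (zero)
  open MapSums R
  open import Algebra.Properties.CommutativeMonoid.Sum *-commutativeMonoid
    using () renaming (sum to product; sum-cong-≋ to product-cong; ∑-distrib-+ to product-distrib-*;
                       ∑-comm to product-comm)
  open FiniteSums *-commutativeMonoid
    using (orientation-independent)
    renaming (sum-ε to product-1; sum-Σ to product-Σ; sum-select to product-select;
              sum-combine₂ to product-combine₂; sum₂-distrib-∙ to product₂-distrib-*)
  open import Algebra.Properties.CommutativeSemigroup *-commutativeSemigroup using (interchange)
  open import Relation.Binary.Reasoning.Setoid setoid

  edgeProduct : (H : Graph) → (Vertex H → Fin m) → Carrier
  edgeProduct H φ = product λ u → product λ v →
    if does ((u <? v) ×-dec Graph.adj? H u v) then w (φ u) (φ v) else 1#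

  edgeProduct-cong : ∀ H → Extensional (edgeProduct H)
  edgeProduct-cong H φ≗ψ = product-cong λ u → product-cong λ v → reflexive
    (≡.cong₂ (λ x y → if does ((u <? v) ×-dec Graph.adj? H u v) then w x y else 1#) (φ≗ψ u) (φ≗ψ v))

  -- After reorientation by `lex` the double product splits into blocks indexed by pairs of parts:
  -- diagonal blocks are the edge products of the parts, and the blocks with `i < j` collect the
  -- edges between them. The relation `C` is arbitrary because adjacency between parts depends only
  -- on the parts for `H`, but also on the layers for `H ×K₂`.
  edgeProduct-Σ : (∀ x y → w x y ≈ w y x) → ∀ {k} (K : Graph) (parts : Fin k → Graph)
    (label : Vertex K ↔ Σ (Fin k) (Vertex ∘ parts))
    (C : ∀ i j → Vertex (parts i) → Vertex (parts j) → Bool) →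
    (∀ i u v → does (Graph.adj? K (from label (i , u)) (from label (i , v))) ≡ does (Graph.adj? (parts i) u v)) →
    (∀ i j u v → i ≢ j → does (Graph.adj? K (from label (i , u)) (from label (j , v))) ≡ C i j u v) →
    ∀ φ → edgeProduct K φ ≈
      (product λ i → edgeProduct (parts i) (λ u → φ (from label (i , u)))) *
      (product λ i → product λ j → if does (i <? j)
         then (product λ u → product λ v →
           if C i j u v then w (φ (from label (i , u))) (φ (from label (j , v))) else 1#)
         else 1#)
  edgeProduct-Σ w-sym {k} K parts label C within between φ = begin
    edgeProduct K φ
      ≈⟨ orientation-independent adj (λ x y → does (x <? y)) (λ x y → lex (to label x) (to label y)) W
           (λ x y → does-⇔ (mk⇔ (Graph.symm K) (Graph.symm K)) (Graph.adj? K x y) (Graph.adj? K y x))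
           (λ x y → w-sym (φ x) (φ y))
           (λ x y xy → <?-anti {u = x} {y} (≢-adj xy))
           (λ x y xy → lex-anti {p = to label x} {to label y} λ eq → ≢-adj xy (to-injective eq)) ⟩
    (product λ x → product λ y → term (lex (to label x) (to label y)) x y)
      ≈⟨ product-Σ n label _ ⟩
    (product λ i → product λ u → product λ y → term (lex (to label (at i u)) (to label y)) (at i u) y)
      ≈⟨ product-cong {k} (λ i → product-cong {n i} λ u →
           product-Σ n label λ y → term (lex (to label (at i u)) (to label y)) (at i u) y) ⟩
    (product λ i → product λ u → product λ j → product λ v →
       term (lex (to label (at i u)) (to label (at j v))) (at i u) (at j v))
      ≈⟨ product-cong (λ i → product-cong λ u → product-cong λ j → product-cong λ v → reflexive
           (≡.cong₂ (λ p q → term (lex p q) (at i u) (at j v))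
             (strictlyInverseˡ label (i , u)) (strictlyInverseˡ label (j , v)))) ⟩
    (product λ i → product λ u → product λ j → product λ v →
       term (lex {n = n} (i , u) (j , v)) (at i u) (at j v))
      ≈⟨ product-cong (λ i → product-comm λ u j → product λ v → term (lex {n = n} (i , u) (j , v)) (at i u) (at j v)) ⟩
    (product λ i → product λ j → product λ u → product λ v →
       term (lex {n = n} (i , u) (j , v)) (at i u) (at j v))
      ≈⟨ product-cong (λ i → product-cong λ j → split i j (i <? j) (i ≟ j)) ⟩
    (product λ i → product λ j → diagonal i j * offDiagonal i j)
      ≈⟨ product₂-distrib-* diagonal offDiagonal ⟩
    (product λ i → product (diagonal i)) * (product λ i → product (offDiagonal i))
      ≈⟨ *-congʳ (product-cong λ i → product-select i inside) ⟩
    product inside * (product λ i → product (offDiagonal i)) ∎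
    where
    n : Fin k → ℕ
    n i = Graph.order (parts i)

    at : ∀ i → Vertex (parts i) → Vertex K
    at i u = from label (i , u)

    adj : Vertex K → Vertex K → Bool
    adj x y = does (Graph.adj? K x y)

    W : Vertex K → Vertex K → Carrier
    W x y = w (φ x) (φ y)

    term : Bool → Vertex K → Vertex K → Carrier
    term b x y = if b ∧ adj x y then W x y else 1#

    inside : Fin k → Carrier
    inside i = edgeProduct (parts i) (φ ∘ at i)

    crossing : Fin k → Fin k → Carrier
    crossing i j = product λ u → product λ v → if C i j u v then W (at i u) (at j v) else 1#

    diagonal offDiagonal : Fin k → Fin k → Carrier
    diagonal i j = if does (i ≟ j) then inside j else 1#
    offDiagonal i j = if does (i <? j) then crossing i j else 1#

    ≢-adj : ∀ {x y} → adj x y ≡ true → x ≢ y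
    ≢-adj {x} {y} xy x≡y = Graph.irrefl K x≡y (does-true (Graph.adj? K x y) xy)

    to-injective : ∀ {x y} → to label x ≡ to label y → x ≡ y
    to-injective {x} {y} eq = ≡.trans (≡.sym (strictlyInverseʳ label x))
      (≡.trans (≡.cong (from label) eq) (strictlyInverseʳ label y))

    split : ∀ i j (i<?j : Dec (i < j)) (i≟j : Dec (i ≡ j)) →
      (product λ u → product λ v →
         term (does i<?j ∨ (does i≟j ∧ does (u <? v))) (at i u) (at j v)) ≈
      (if does i≟j then inside j else 1#) * (if does i<?j then crossing i j else 1#)
    split i j (yes i<j) (yes i≡j) = contradiction i≡j (<⇒≢ i<j)
    split i j (yes i<j) (no  i≢j) = sym (trans (*-identityˡ _)
      (product-cong λ u → product-cong λ v → reflexive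
        (≡.cong (λ b → if b then W (at i u) (at j v) else 1#) (≡.sym (between i j u v i≢j)))))
    split i j (no _) (yes ≡.refl) = sym (trans (*-identityʳ _)
      (product-cong λ u → product-cong λ v → reflexive
        (≡.cong (λ b → if does (u <? v) ∧ b then W (at i u) (at i v) else 1#) (≡.sym (within i u v)))))
    -- Here `j < i`: the edges between these two parts are counted in the block `(j , i)`.
    split i j (no _) (no _) = trans
      (product-1 {n i} _ λ u → product-1 {n j} (λ _ → 1#) λ v → refl)
      (sym (*-identityˡ _))

  if-cong : ∀ b {x y} → x ≈ y → (if b then x else 1#) ≈ (if b then y else 1#)
  if-cong false _  = refl
  if-cong true x≈y = x≈y

  if-* : ∀ b {x y} → (if b then x else 1#) * (if b then y else 1#) ≈ (if b then x * y else 1#)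
  if-* false = *-identityˡ 1#
  if-* true  = refl

  product₂-1 : ∀ a b → (product {a} λ _ → product {b} λ _ → 1#) ≈ 1#
  product₂-1 a b = product-1 {a} _ λ _ → product-1 {b} (λ _ → 1#) λ _ → refl

  -- The weight of all edges that join two doubled parts and change the layer.
  crossProduct : ∀ {a b} → (Fin (a ℕ.* 2) → Fin m) → (Fin (b ℕ.* 2) → Fin m) → Carrier
  crossProduct {a} {b} ξ η = product λ (u : Fin a) → product λ (v : Fin b) →
    w (ξ (combine u 0F)) (η (combine v 1F)) * w (ξ (combine u 1F)) (η (combine v 0F))

  -- Of the four pairs of layers over given `u` and `v`, the two that stay within one layer
  -- contribute `1#`.
  crossProduct-layers : ∀ {a b} (adj : Bool) (ξ : Fin (a ℕ.* 2) → Fin m) (η : Fin (b ℕ.* 2) → Fin m) →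
    (product λ p → product λ q →
       if adj ∧ not (does (layer {a} p ≟ layer {b} q)) then w (ξ p) (η q) else 1#) ≈
    (if adj then crossProduct {a} {b} ξ η else 1#)
  crossProduct-layers {a} {b} false ξ η = product₂-1 (a ℕ.* 2) (b ℕ.* 2)
  crossProduct-layers {a} {b} true ξ η = begin
    (product λ p → product λ q → term p q)
      ≈⟨ product-combine₂ a _ ⟩
    (product λ (u : Fin a) → product (term (combine u 0F)) * product (term (combine u 1F)))
      ≈⟨ product-cong {a} (λ u → trans (sym (product-distrib-* (term (combine u 0F)) (term (combine u 1F))))
           (trans (product-combine₂ b (λ q → term (combine u 0F) q * term (combine u 1F) q))
             (product-cong {b} (λ v → simplify u v)))) ⟩
    crossProduct {a} {b} ξ η ∎
    where
    term : Fin (a ℕ.* 2) → Fin (b ℕ.* 2) → Carrier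
    term p q = if not (does (layer {a} p ≟ layer {b} q)) then w (ξ p) (η q) else 1#

    simplify : ∀ (u : Fin a) (v : Fin b) →
      (term (combine u 0F) (combine v 0F) * term (combine u 1F) (combine v 0F)) *
      (term (combine u 0F) (combine v 1F) * term (combine u 1F) (combine v 1F)) ≈
      w (ξ (combine u 0F)) (η (combine v 1F)) * w (ξ (combine u 1F)) (η (combine v 0F))
    simplify u v
      rewrite layer-combine u 0F | layer-combine u 1F | layer-combine v 0F | layer-combine v 1F =
      trans (*-cong (*-identityˡ _) (*-identityʳ _)) (*-comm _ _)

  -- The common factor of both sides: after `twist`, the edges between parts weigh the same in two
  -- copies of `H` as in `H ×K₂`.
  interaction : ∀ {k} (n : Fin k → ℕ) (adj : Fin k → Fin k → Bool) →
                (∀ i → Fin (n i ℕ.* 2) → Fin m) → Carrier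
  interaction n adj χ = product λ i → product λ j →
    if does (i <? j) then (if adj i j then crossProduct {n i} {n j} (χ i) (χ j) else 1#) else 1#

  twoCopies doubleCover : (H : Graph) → (Fin (Graph.order H ℕ.* 2) → Fin m) → Carrier
  twoCopies H ξ = edgeProduct H (λ u → ξ (combine u 0F)) * edgeProduct H (λ u → ξ (combine u 1F))
  doubleCover H = edgeProduct (H ×K₂)

  interaction-cong : ∀ {k} (n : Fin k → ℕ) adj → Extensionalᵈ {n = λ i → n i ℕ.* 2} (interaction n adj)
  interaction-cong {k} n adj {χ} {χ′} χ≗χ′ = product-cong {k} λ i → product-cong {k} λ j →
    if-cong (does (i <? j)) (if-cong (adj i j)
      (product-cong {n i} λ u → product-cong {n j} λ v → *-cong
        (reflexive (≡.cong₂ w (χ≗χ′ i _) (χ≗χ′ j _))) (reflexive (≡.cong₂ w (χ≗χ′ i _) (χ≗χ′ j _)))))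

  -- Both homomorphism counts as sums over families of maps

  module BlowUp (w-sym : ∀ x y → w x y ≈ w y x)
    {k} (H : Graph) (parts : Fin k → Graph) (label : Vertex H ↔ Σ (Fin k) (Vertex ∘ parts))
    (adj : Fin k → Fin k → Bool)
    (within : ∀ i u v → does (Graph.adj? H (from label (i , u)) (from label (i , v))) ≡ does (Graph.adj? (parts i) u v))
    (between : ∀ i j u v → i ≢ j → does (Graph.adj? H (from label (i , u)) (from label (j , v))) ≡ adj i j)
    where

    n n₂ : Fin k → ℕ
    n i = Graph.order (parts i)
    n₂ i = n i ℕ.* 2

    hom-×K₂ : sumMaps (edgeProduct (H ×K₂)) ≈
      sumFamilies n₂ λ χ → (product λ i → doubleCover (parts i) (χ i)) * interaction n adj χ
    hom-×K₂ = trans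
      (sumFamilies-relabel n₂ label₂ (edgeProduct (H ×K₂)) (edgeProduct-cong (H ×K₂)))
      (sumFamilies-cong n₂ pointwise)
      where
      label₂ : Vertex (H ×K₂) ↔ Σ (Fin k) (λ i → Vertex (parts i ×K₂))
      label₂ = doubledLabel n label

      pointwise : ∀ χ → edgeProduct (H ×K₂) (λ x → χ (proj₁ (to label₂ x)) (proj₂ (to label₂ x))) ≈
        (product λ i → doubleCover (parts i) (χ i)) * interaction n adj χ
      pointwise χ = trans
        (edgeProduct-Σ w-sym (H ×K₂) (λ i → parts i ×K₂) label₂
          -- Between different parts, adjacency in `H ×K₂` means adjacency of the parts together
          -- with a change of layer.
          (λ i j p q → adj i j ∧ not (does (layer {n i} p ≟ layer {n j} q)))
          (λ i p q → ≡.trans (adj?-×K₂ H _ _ (layer {n i} p) (layer {n i} q))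
            (≡.cong (_∧ not (does (layer {n i} p ≟ layer {n i} q))) (within i _ _)))
          (λ i j p q i≢j → ≡.trans (adj?-×K₂ H _ _ (layer {n i} p) (layer {n j} q))
            (≡.cong (_∧ not (does (layer {n i} p ≟ layer {n j} q))) (between i j _ _ i≢j)))
          _)
        (*-cong
          (product-cong λ i → edgeProduct-cong (parts i ×K₂) λ p → at i p)
          (product-cong λ i → product-cong λ j → if-cong (does (i <? j)) (trans
            (product-cong λ p → product-cong λ q → if-cong (adj i j ∧ not (does (layer {n i} p ≟ layer {n j} q)))
              (reflexive (≡.cong₂ w (at i p) (at j q))))
            (crossProduct-layers {n i} {n j} (adj i j) (χ i) (χ j)))))
        where
        at : ∀ i p → χ (proj₁ (to label₂ (from label₂ (i , p)))) (proj₂ (to label₂ (from label₂ (i , p)))) ≡ χ i p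
        at i p = ≡.cong (λ (j , q) → χ j q) (strictlyInverseˡ label₂ (i , p))

    module _ (side : Fin k → Fin 2) (bipartite : ∀ i j → adj i j ≡ true → side i ≢ side j) where

      -- A pair of maps `φ`, `ψ` is one map on two copies of `H`, and `twist` regroups it by parts.
      -- The comparison with `interaction` is where bipartiteness enters.
      hom² : sumMaps (edgeProduct H) * sumMaps (edgeProduct H) ≈
        sumFamilies n₂ λ χ → (product λ i → twoCopies (parts i) (χ i)) * interaction n adj χ
      hom² = begin
        sumMaps E * sumMaps E
          ≈⟨ sumMaps-*ʳ _ E ⟩
        (sumMaps λ φ → E φ * sumMaps E)
          ≈⟨ sumMaps-cong (λ φ → sumMaps-*ˡ (E φ) E) ⟩
        (sumMaps λ φ → sumMaps λ ψ → E φ * E ψ)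
          ≈⟨ sumMaps-cong (λ φ → sumMaps-cong λ ψ → pointwise φ ψ) ⟩
        (sumMaps λ φ → sumMaps λ ψ → f (λ i p → [ φ , ψ ]′ (to (twist n label side) (i , p))))
          ≈⟨ sumFamilies-⊎ n₂ (twist n label side) f f-ext ⟨
        sumFamilies n₂ f ∎
        where
        E : (Vertex H → Fin m) → Carrier
        E = edgeProduct H

        f : (∀ i → Fin (n₂ i) → Fin m) → Carrier
        f χ = (product λ i → twoCopies (parts i) (χ i)) * interaction n adj χ

        f-ext : Extensionalᵈ f
        f-ext χ≗χ′ = *-cong
          (product-cong λ i → *-cong (edgeProduct-cong (parts i) λ u → χ≗χ′ i _)
                                     (edgeProduct-cong (parts i) λ u → χ≗χ′ i _))
          (interaction-cong n adj χ≗χ′)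

        pointwise : ∀ φ ψ → E φ * E ψ ≈ f (λ i p → [ φ , ψ ]′ (to (twist n label side) (i , p)))
        pointwise φ ψ = begin
          E φ * E ψ
            ≈⟨ *-cong (decompose φ) (decompose ψ) ⟩
          (product (inside φ) * (product λ i → product (crossing φ i))) *
          (product (inside ψ) * (product λ i → product (crossing ψ i)))
            ≈⟨ interchange _ _ _ _ ⟩
          (product (inside φ) * product (inside ψ)) *
          ((product λ i → product (crossing φ i)) * (product λ i → product (crossing ψ i)))
            ≈⟨ *-cong (product-distrib-* (inside φ) (inside ψ)) (product₂-distrib-* (crossing φ) (crossing ψ)) ⟨
          (product λ i → inside φ i * inside ψ i) * (product λ i → product λ j → crossing φ i j * crossing ψ i j)
            ≈⟨ *-cong (product-cong λ i → inside-twist i)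
                 (product-cong λ i → product-cong λ j → trans (if-* (does (i <? j)))
                   (if-cong (does (i <? j)) (crossing-twist i j (adj i j) ≡.refl))) ⟩
          f χ ∎
          where
          at : ∀ i → Vertex (parts i) → Vertex H
          at i u = from label (i , u)

          χ : ∀ i → Fin (n₂ i) → Fin m
          χ i p = [ φ , ψ ]′ (to (twist n label side) (i , p))

          inside : (Vertex H → Fin m) → Fin k → Carrier
          inside θ i = edgeProduct (parts i) (θ ∘ at i)

          between-parts : (Vertex H → Fin m) → Fin k → Fin k → Bool → Carrier
          between-parts θ i j b = product λ u → product λ v → if b then w (θ (at i u)) (θ (at j v)) else 1#

          crossing : (Vertex H → Fin m) → Fin k → Fin k → Carrier
          crossing θ i j = if does (i <? j) then between-parts θ i j (adj i j) else 1#

          decompose : ∀ θ → E θ ≈ product (inside θ) * (product λ i → product (crossing θ i))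
          decompose = edgeProduct-Σ w-sym H parts label (λ i j _ _ → adj i j) within between

          value : Fin 2 → ∀ i → Vertex (parts i) → Fin 2 → Fin m
          value s i u l = [ φ , ψ ]′ (to ×Fin2↔⊎ (at i u , to (shift s) l))

          χ-value : ∀ i u l → χ i (combine u l) ≡ value (side i) i u l
          χ-value i u l = ≡.cong [ φ , ψ ]′ (to-twist n label side i u l)

          inside-twist : ∀ i → inside φ i * inside ψ i ≈ twoCopies (parts i) (χ i)
          inside-twist i = trans (go (side i))
            (sym (*-cong (edgeProduct-cong (parts i) λ u → χ-value i u 0F)
                         (edgeProduct-cong (parts i) λ u → χ-value i u 1F)))
            where
            -- Exchanging the copies inside a single part only exchanges the two factors.
            go : ∀ s → inside φ i * inside ψ i ≈
                 edgeProduct (parts i) (λ u → value s i u 0F) * edgeProduct (parts i) (λ u → value s i u 1F)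
            go 0F = refl
            go 1F = *-comm _ _

          crossing-twist : ∀ i j b → adj i j ≡ b → between-parts φ i j b * between-parts ψ i j b ≈
            (if b then crossProduct {n i} {n j} (χ i) (χ j) else 1#)
          crossing-twist i j false _ = trans (*-cong (product₂-1 (n i) (n j)) (product₂-1 (n i) (n j))) (*-identityˡ 1#)
          crossing-twist i j true ij = begin
            between-parts φ i j true * between-parts ψ i j true
              ≈⟨ product₂-distrib-* (λ u v → w (φ (at i u)) (φ (at j v))) (λ u v → w (ψ (at i u)) (ψ (at j v))) ⟨
            (product λ u → product λ v → w (φ (at i u)) (φ (at j v)) * w (ψ (at i u)) (ψ (at j v)))
              ≈⟨ product-cong (λ u → product-cong λ v → trans (go u v (side i) (side j) (bipartite i j ij))
                   (reflexive (≡.sym (≡.cong₂ _*_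
                     (≡.cong₂ w (χ-value i u 0F) (χ-value j v 1F))
                     (≡.cong₂ w (χ-value i u 1F) (χ-value j v 0F)))))) ⟩
            crossProduct {n i} {n j} (χ i) (χ j) ∎
            where
            -- The vertex `(u , 0)` lies in copy `s` and `(v , 1)` in copy `t + 1` modulo 2. These
            -- coincide because `s` and `t` differ, so each edge that changes the layer comes from
            -- an edge within one copy.
            go : ∀ u v s t → s ≢ t → w (φ (at i u)) (φ (at j v)) * w (ψ (at i u)) (ψ (at j v)) ≈
              w (value s i u 0F) (value t j v 1F) * w (value s i u 1F) (value t j v 0F)
            go u v 0F 0F s≢t = contradiction ≡.refl s≢t
            go u v 0F 1F s≢t = refl
            go u v 1F 0F s≢t = *-comm _ _
            go u v 1F 1F s≢t = contradiction ≡.refl s≢t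

-- Replacing the parts one at a time

-- The laws on which the swapping argument rests. Working over them keeps the combinatorics apart
-- from Cauchy sequences.
record OrderedCommutativeSemiring c ℓ₁ ℓ₂ : Set (lsuc (c ⊔ ℓ₁ ⊔ ℓ₂)) where
  infix 4 _≤_
  field
    commutativeSemiring : CommutativeSemiring c ℓ₁
  open CommutativeSemiring commutativeSemiring public
  field
    _≤_          : Rel Carrier ℓ₂
    ≤-isPreorder : IsPreorder _≈_ _≤_
    +-mono-≤     : ∀ {x y u v} → x ≤ y → u ≤ v → x + u ≤ y + v
    *-monoˡ-≤    : ∀ {x y z} → 0# ≤ x → y ≤ z → x * y ≤ x * z
    0≤1          : 0# ≤ 1#

  ≤-preorder : Preorder c ℓ₁ ℓ₂
  ≤-preorder = record { isPreorder = ≤-isPreorder }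

module Swapping {c ℓ₁ ℓ₂} (S : OrderedCommutativeSemiring c ℓ₁ ℓ₂) {m : ℕ}
  (w : Fin m → Fin m → OrderedCommutativeSemiring.Carrier S) where

  open OrderedCommutativeSemiring S hiding (zero)
  open IsPreorder ≤-isPreorder using (≲-respˡ-≈; ≲-respʳ-≈) renaming (refl to ≤-refl)
  open MapSums commutativeSemiring
  open Edges commutativeSemiring w
  open import Algebra.Properties.Semiring.Sum semiring using (sum; sum-cong-≋)
  open import Algebra.Properties.CommutativeMonoid.Sum *-commutativeMonoid
    using () renaming (sum to product; sum-cong-≋ to product-cong; ∑-distrib-+ to product-distrib-*;
                       ∑-comm to product-comm)
  open FiniteSums *-commutativeMonoid using () renaming (sum-ε to product-1)
  open import Algebra.Properties.CommutativeSemigroup *-commutativeSemigroup using (interchange; x∙yz≈y∙xz)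
  open import Relation.Binary.Reasoning.Preorder ≤-preorder

  sum-mono-≤ : ∀ {n} {f g : Fin n → Carrier} → (∀ i → f i ≤ g i) → sum f ≤ sum g
  sum-mono-≤ {zero}  f≤g = ≤-refl
  sum-mono-≤ {suc n} f≤g = +-mono-≤ (f≤g zero) (sum-mono-≤ (f≤g ∘ suc))

  opaque
    unfolding sumMaps

    sumMaps-mono-≤ : ∀ {n n′} {f g : (Fin n → Fin n′) → Carrier} → (∀ φ → f φ ≤ g φ) → sumMaps f ≤ sumMaps g
    sumMaps-mono-≤ f≤g = sum-mono-≤ (λ i → f≤g (finToFun i))

  opaque
    unfolding sumFamilies

    sumFamilies-mono-≤ : ∀ {k n′} (n : Fin k → ℕ) {f g : (∀ i → Fin (n i) → Fin n′) → Carrier} →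
                         (∀ χ → f χ ≤ g χ) → sumFamilies n f ≤ sumFamilies n g
    sumFamilies-mono-≤ n f≤g = sumMaps-mono-≤ λ _ → f≤g _

  *-nonneg : ∀ {x y} → 0# ≤ x → 0# ≤ y → 0# ≤ x * y
  *-nonneg {x} 0≤x 0≤y = ≲-respˡ-≈ (zeroʳ x) (*-monoˡ-≤ 0≤x 0≤y)

  product-nonneg : ∀ {n} (f : Fin n → Carrier) → (∀ i → 0# ≤ f i) → 0# ≤ product f
  product-nonneg {zero}  f 0≤f = 0≤1
  product-nonneg {suc n} f 0≤f = *-nonneg (0≤f zero) (product-nonneg (f ∘ suc) (0≤f ∘ suc))

  if-nonneg : ∀ b {x} → 0# ≤ x → 0# ≤ (if b then x else 1#)
  if-nonneg false _  = 0≤1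
  if-nonneg true 0≤x = 0≤x

  CrossSwapping : Graph → Set (c ⊔ ℓ₂)
  CrossSwapping H =
    (a b : Fin m → Carrier) → (∀ x → 0# ≤ a x) → (∀ x → 0# ≤ b x) →
      (sumMaps λ φ → edgeProduct H φ * product λ u → a (φ u)) *
      (sumMaps λ φ → edgeProduct H φ * product λ u → b (φ u))
    ≤ (sumMaps λ ψ → edgeProduct (H ×K₂) ψ *
         product λ (u : Vertex H) → a (ψ (combine u 0F)) * b (ψ (combine u 1F)))

  weightProduct : ∀ n → (a b : Fin m → Carrier) → (Fin (n ℕ.* 2) → Fin m) → Carrier
  weightProduct n a b ξ = product λ (u : Fin n) → a (ξ (combine u 0F)) * b (ξ (combine u 1F))

  weightProduct-cong : ∀ n a b → Extensional (weightProduct n a b)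
  weightProduct-cong n a b ξ≗ξ′ = product-cong {n} λ u →
    *-cong (reflexive (≡.cong a (ξ≗ξ′ _))) (reflexive (≡.cong b (ξ≗ξ′ _)))

  twoCopies-cong : ∀ H → Extensional (twoCopies H)
  twoCopies-cong H ξ≗ξ′ = *-cong (edgeProduct-cong H λ u → ξ≗ξ′ _) (edgeProduct-cong H λ u → ξ≗ξ′ _)

  -- A map on two layers is a pair of maps and the summand is a product over the layers, so the
  -- double sum factors. This gives the left side of `CrossSwapping` the same shape as its right
  -- side.
  sum-twoCopies : ∀ H a b → sumMaps (λ ξ → twoCopies H ξ * weightProduct (Graph.order H) a b ξ) ≈
    (sumMaps λ φ → edgeProduct H φ * product λ u → a (φ u)) *
    (sumMaps λ φ → edgeProduct H φ * product λ u → b (φ u))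
  sum-twoCopies H a b = trans
    (sumMaps-⊎ (×Fin2↔⊎ ↔-∘ *↔×) _
      (λ ξ≗ξ′ → *-cong (twoCopies-cong H ξ≗ξ′) (weightProduct-cong (Graph.order H) a b ξ≗ξ′)))
    (trans (sumMaps-cong λ α → sumMaps-cong λ β → trans
        (*-cong (*-cong (edgeProduct-cong H λ u → ≡.cong [ α , β ]′ (at u 0F))
                        (edgeProduct-cong H λ u → ≡.cong [ α , β ]′ (at u 1F)))
          (trans (product-cong λ u → *-cong (reflexive (≡.cong (a ∘ [ α , β ]′) (at u 0F)))
                                            (reflexive (≡.cong (b ∘ [ α , β ]′) (at u 1F))))
                 (product-distrib-* (a ∘ α) (b ∘ β))))
        (interchange _ _ _ _))
      (sym (trans (sumMaps-*ʳ _ _) (sumMaps-cong λ φ → sumMaps-*ˡ _ _))))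
    where
    at : ∀ (u : Vertex H) l → to ×Fin2↔⊎ (remQuot 2 (combine u l)) ≡ to ×Fin2↔⊎ (u , l)
    at u l = ≡.cong (to ×Fin2↔⊎) (remQuot-combine u l)

  -- With the maps of all other parts fixed to χ₀, the value of K depends on the
  -- map of the i-th part through vertex weights a, b on the two layers only.
  SeparableAt : ∀ {k} (n : Fin k → ℕ) i → (∀ j → j ≢ i → Fin (n j ℕ.* 2) → Fin m) →
                ((∀ i → Fin (n i ℕ.* 2) → Fin m) → Carrier) → Set (c ⊔ ℓ₁ ⊔ ℓ₂)
  SeparableAt n i χ₀ K =
    ∃[ x ] ∃[ a ] ∃[ b ] 0# ≤ x × (∀ y → 0# ≤ a y) × (∀ y → 0# ≤ b y) ×
      (∀ χ → (∀ j (j≢i : j ≢ i) → χ j ≡ χ₀ j j≢i) → K χ ≈ x * weightProduct (n i) a b (χ i))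

  module _ {k} (n : Fin k → ℕ) (i : Fin k) (χ₀ : ∀ j → j ≢ i → Fin (n j ℕ.* 2) → Fin m) where

    private
      Family : Set
      Family = ∀ i → Fin (n i ℕ.* 2) → Fin m

    separable-const : ∀ {K : Family → Carrier} x → 0# ≤ x →
      (∀ χ → (∀ j (j≢i : j ≢ i) → χ j ≡ χ₀ j j≢i) → K χ ≈ x) → SeparableAt n i χ₀ K
    separable-const x 0≤x K≈x = x , (λ _ → 1#) , (λ _ → 1#) , 0≤x , (λ _ → 0≤1) , (λ _ → 0≤1) , λ χ χ≡ →
      trans (K≈x χ χ≡) (sym (trans (*-congˡ (product-1 {n i} (λ _ → 1# * 1#) λ _ → *-identityˡ 1#)) (*-identityʳ x)))

    -- Constants and vertex weights multiply separately, so separability of `interaction` reduces to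
    -- that of its factors.
    separable-* : ∀ {K L : Family → Carrier} → SeparableAt n i χ₀ K → SeparableAt n i χ₀ L →
                  SeparableAt n i χ₀ (λ χ → K χ * L χ)
    separable-* (x , a , b , 0≤x , 0≤a , 0≤b , K≈) (x′ , a′ , b′ , 0≤x′ , 0≤a′ , 0≤b′ , L≈) =
      x * x′ , (λ y → a y * a′ y) , (λ y → b y * b′ y) ,
      *-nonneg 0≤x 0≤x′ , (λ y → *-nonneg (0≤a y) (0≤a′ y)) , (λ y → *-nonneg (0≤b y) (0≤b′ y)) ,
      λ χ χ≡ → trans (*-cong (K≈ χ χ≡) (L≈ χ χ≡)) (trans (interchange _ _ _ _) (*-congˡ
        (trans (sym (product-distrib-* {n i} _ _)) (product-cong {n i} λ u → interchange _ _ _ _))))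

    separable-product : ∀ {l} (K : Fin l → Family → Carrier) → (∀ j → SeparableAt n i χ₀ (K j)) →
                        SeparableAt n i χ₀ (λ χ → product λ j → K j χ)
    separable-product {zero}  K K-sep = separable-const 1# 0≤1 λ _ _ → refl
    separable-product {suc l} K K-sep = separable-* (K-sep zero) (separable-product (K ∘ suc) (K-sep ∘ suc))

    module _ (w-nonneg : ∀ x y → 0# ≤ w x y) where

      -- If one of the two parts is `i`, the other has a fixed map, and the product over its
      -- vertices is a weight on the vertices of part `i`. Since `j₁ ≢ j₂`, no factor couples two
      -- vertices of part `i`. The weight `a` for layer 0 reads layer 1 of the other part, and `b`
      -- reads layer 0.
      separable-crossProduct : ∀ j₁ j₂ → j₁ ≢ j₂ →
        SeparableAt n i χ₀ (λ χ → crossProduct {n j₁} {n j₂} (χ j₁) (χ j₂))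
      separable-crossProduct j₁ j₂ j₁≢j₂ with j₁ ≟ i | j₂ ≟ i
      ... | yes ≡.refl | yes ≡.refl = contradiction ≡.refl j₁≢j₂
      ... | yes ≡.refl | no j₂≢i = 1# ,
        (λ y → product λ (v : Fin (n j₂)) → w y (χ₀ j₂ j₂≢i (combine v 1F))) ,
        (λ y → product λ (v : Fin (n j₂)) → w y (χ₀ j₂ j₂≢i (combine v 0F))) ,
        0≤1 , (λ y → product-nonneg {n j₂} _ λ v → w-nonneg _ _) , (λ y → product-nonneg {n j₂} _ λ v → w-nonneg _ _) ,
        λ χ χ≡ → trans
          (product-cong {n i} λ u → trans (product-distrib-* {n j₂} _ _)
            (reflexive (≡.cong (λ η →
              (product λ (v : Fin (n j₂)) → w (χ i (combine u 0F)) (η (combine v 1F))) *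
              (product λ (v : Fin (n j₂)) → w (χ i (combine u 1F)) (η (combine v 0F)))) (χ≡ j₂ j₂≢i))))
          (sym (*-identityˡ _))
      ... | no j₁≢i | yes ≡.refl = 1# ,
        (λ y → product λ (u : Fin (n j₁)) → w (χ₀ j₁ j₁≢i (combine u 1F)) y) ,
        (λ y → product λ (u : Fin (n j₁)) → w (χ₀ j₁ j₁≢i (combine u 0F)) y) ,
        0≤1 , (λ y → product-nonneg {n j₁} _ λ u → w-nonneg _ _) , (λ y → product-nonneg {n j₁} _ λ u → w-nonneg _ _) ,
        -- Part `i` is now the second index: its product is moved outside, and `*-comm` then puts
        -- the factor of its layer 0 first.
        λ χ χ≡ → trans (product-comm {n j₁} {n i} _) (trans
          (product-cong {n i} λ v → trans (product-distrib-* {n j₁} _ _) (trans (*-comm _ _)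
            (reflexive (≡.cong (λ η →
              (product λ (u : Fin (n j₁)) → w (η (combine u 1F)) (χ i (combine v 0F))) *
              (product λ (u : Fin (n j₁)) → w (η (combine u 0F)) (χ i (combine v 1F)))) (χ≡ j₁ j₁≢i)))))
          (sym (*-identityˡ _)))
      ... | no j₁≢i | no j₂≢i = separable-const
        (crossProduct {n j₁} {n j₂} (χ₀ j₁ j₁≢i) (χ₀ j₂ j₂≢i))
        (product-nonneg {n j₁} _ λ u → product-nonneg {n j₂} _ λ v → *-nonneg (w-nonneg _ _) (w-nonneg _ _))
        λ χ χ≡ → reflexive (≡.cong₂ (crossProduct {n j₁} {n j₂}) (χ≡ j₁ j₁≢i) (χ≡ j₂ j₂≢i))

      separable-interaction : ∀ adj → SeparableAt n i χ₀ (interaction n adj)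
      separable-interaction adj = separable-product _ λ j₁ → separable-product _ λ j₂ →
        go j₁ j₂ (j₁ <? j₂) (adj j₁ j₂)
        where
        go : ∀ j₁ j₂ (j₁<?j₂ : Dec (j₁ < j₂)) b → SeparableAt n i χ₀ λ χ →
          if does j₁<?j₂ then (if b then crossProduct {n j₁} {n j₂} (χ j₁) (χ j₂) else 1#) else 1#
        go j₁ j₂ (no  _)     b     = separable-const 1# 0≤1 λ _ _ → refl
        go j₁ j₂ (yes _)     false = separable-const 1# 0≤1 λ _ _ → refl
        go j₁ j₂ (yes j₁<j₂) true  = separable-crossProduct j₁ j₂ (<⇒≢ j₁<j₂)

  module _ (w-nonneg : ∀ x y → 0# ≤ w x y) where

    edgeProduct-nonneg : ∀ H φ → 0# ≤ edgeProduct H φ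
    edgeProduct-nonneg H φ = product-nonneg _ λ u → product-nonneg _ λ v →
      if-nonneg (does ((u <? v) ×-dec Graph.adj? H u v)) (w-nonneg (φ u) (φ v))

    -- The constant `x` comes from the factors that do not involve the part. It is taken out of the
    -- sum, and being nonnegative it preserves the inequality.
    swapPart : ∀ H → CrossSwapping H → ∀ x a b → 0# ≤ x → (∀ y → 0# ≤ a y) → (∀ y → 0# ≤ b y) →
      sumMaps (λ ξ → twoCopies H ξ * (x * weightProduct (Graph.order H) a b ξ)) ≤
      sumMaps (λ ξ → doubleCover H ξ * (x * weightProduct (Graph.order H) a b ξ))
    swapPart H swaps x a b 0≤x 0≤a 0≤b = begin
      sumMaps (λ ξ → twoCopies H ξ * (x * P ξ))
        ≈⟨ sumMaps-cong (λ ξ → x∙yz≈y∙xz (twoCopies H ξ) x (P ξ)) ⟩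
      sumMaps (λ ξ → x * (twoCopies H ξ * P ξ))
        ≈⟨ sumMaps-*ˡ x _ ⟨
      x * sumMaps (λ ξ → twoCopies H ξ * P ξ)
        ≈⟨ *-congˡ (sum-twoCopies H a b) ⟩
      x * ((sumMaps λ φ → edgeProduct H φ * product λ u → a (φ u)) *
           (sumMaps λ φ → edgeProduct H φ * product λ u → b (φ u)))
        ≲⟨ *-monoˡ-≤ 0≤x (swaps a b 0≤a 0≤b) ⟩
      x * sumMaps (λ ξ → doubleCover H ξ * P ξ)
        ≈⟨ sumMaps-*ˡ x _ ⟩
      sumMaps (λ ξ → x * (doubleCover H ξ * P ξ))
        ≈⟨ sumMaps-cong (λ ξ → x∙yz≈y∙xz x (doubleCover H ξ) (P ξ)) ⟩
      sumMaps (λ ξ → doubleCover H ξ * (x * P ξ)) ∎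
      where
      P : (Fin (Graph.order H ℕ.* 2) → Fin m) → Carrier
      P = weightProduct (Graph.order H) a b

    -- Induction on the number of parts. `K` is general because the induction hypothesis is applied
    -- to the function left after the map of the first part has been fixed.
    swapAllParts : ∀ {k} (parts : Fin k → Graph) → (∀ i → CrossSwapping (parts i)) →
      let n = λ i → Graph.order (parts i) ; n₂ = λ i → n i ℕ.* 2 in
      (K : (∀ i → Fin (n₂ i) → Fin m) → Carrier) → Extensionalᵈ K → (∀ i χ₀ → SeparableAt n i χ₀ K) →
      sumFamilies n₂ (λ χ → (product λ i → twoCopies (parts i) (χ i)) * K χ) ≤
      sumFamilies n₂ (λ χ → (product λ i → doubleCover (parts i) (χ i)) * K χ)
    swapAllParts {zero} parts swaps K K-ext K-sep = sumFamilies-mono-≤ _ λ χ → ≤-refl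
    swapAllParts {suc k} parts swaps K K-ext K-sep = begin
      sumFamilies n₂ (λ χ → (product λ i → twoCopies (parts i) (χ i)) * K χ)
        ≈⟨ sumFamilies-suc n₂ _ (λ χ≗χ′ → *-cong
             (product-cong λ i → twoCopies-cong (parts i) (χ≗χ′ i)) (K-ext χ≗χ′)) ⟩
      sumMaps (λ ξ → sumFamilies n₂′ λ χ → (A₀ ξ * A χ) * K (∀-cons ξ χ))
        ≈⟨ sumMaps-cong (λ ξ → trans (sumFamilies-cong n₂′ λ χ → *-assoc (A₀ ξ) (A χ) (K (∀-cons ξ χ)))
             (sym (sumFamilies-*ˡ n₂′ (A₀ ξ) _))) ⟩
      sumMaps (λ ξ → A₀ ξ * sumFamilies n₂′ λ χ → A χ * K (∀-cons ξ χ))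
        -- For each fixed `ξ` all later parts are replaced at once; the factor `A₀ ξ` is
        -- nonnegative.
        ≲⟨ sumMaps-mono-≤ (λ ξ → *-monoˡ-≤
             (*-nonneg (edgeProduct-nonneg H₀ _) (edgeProduct-nonneg H₀ _))
             (swapAllParts (parts ∘ suc) (swaps ∘ suc) (λ χ → K (∀-cons ξ χ))
               (λ χ≗χ′ → K-ext λ { zero _ → ≡.refl ; (suc i) → χ≗χ′ i })
               (tail-separable ξ))) ⟩
      sumMaps (λ ξ → A₀ ξ * sumFamilies n₂′ λ χ → B χ * K (∀-cons ξ χ))
        -- The sum over the first part becomes the inner one, so that the maps of the other parts
        -- are fixed in it.
        ≈⟨ exchange A₀ ⟩
      sumFamilies n₂′ (λ χ → B χ * sumMaps λ ξ → A₀ ξ * K (∀-cons ξ χ))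
        ≲⟨ sumFamilies-mono-≤ n₂′ (λ χ → *-monoˡ-≤
             (product-nonneg _ λ i → edgeProduct-nonneg (parts (suc i) ×K₂) _) (swapHead χ)) ⟩
      sumFamilies n₂′ (λ χ → B χ * sumMaps λ ξ → B₀ ξ * K (∀-cons ξ χ))
        ≈⟨ exchange B₀ ⟨
      sumMaps (λ ξ → B₀ ξ * sumFamilies n₂′ λ χ → B χ * K (∀-cons ξ χ))
        ≈⟨ sumMaps-cong (λ ξ → trans (sumFamilies-*ˡ n₂′ (B₀ ξ) _)
             (sumFamilies-cong n₂′ λ χ → sym (*-assoc (B₀ ξ) (B χ) (K (∀-cons ξ χ))))) ⟩
      sumMaps (λ ξ → sumFamilies n₂′ λ χ → (B₀ ξ * B χ) * K (∀-cons ξ χ))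
        ≈⟨ sumFamilies-suc n₂ _ (λ χ≗χ′ → *-cong
             (product-cong λ i → edgeProduct-cong (parts i ×K₂) (χ≗χ′ i)) (K-ext χ≗χ′)) ⟨
      sumFamilies n₂ (λ χ → (product λ i → doubleCover (parts i) (χ i)) * K χ) ∎
      where
      H₀ : Graph
      H₀ = parts zero

      n n₂ : Fin (suc k) → ℕ
      n i = Graph.order (parts i)
      n₂ i = n i ℕ.* 2

      n₂′ : Fin k → ℕ
      n₂′ i = n₂ (suc i)

      A₀ B₀ : (Fin (n₂ zero) → Fin m) → Carrier
      A₀ = twoCopies H₀
      B₀ = doubleCover H₀

      A B : (∀ i → Fin (n₂′ i) → Fin m) → Carrier
      A χ = product λ i → twoCopies (parts (suc i)) (χ i)
      B χ = product λ i → doubleCover (parts (suc i)) (χ i)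

      exchange : ∀ C₀ → sumMaps (λ ξ → C₀ ξ * sumFamilies n₂′ λ χ → B χ * K (∀-cons ξ χ)) ≈
                        sumFamilies n₂′ (λ χ → B χ * sumMaps λ ξ → C₀ ξ * K (∀-cons ξ χ))
      exchange C₀ = trans
        (sumMaps-cong λ ξ → trans (sumFamilies-*ˡ n₂′ (C₀ ξ) _)
          (sumFamilies-cong n₂′ λ χ → x∙yz≈y∙xz (C₀ ξ) (B χ) (K (∀-cons ξ χ))))
        (trans (sumMaps-sumFamilies-comm n₂′ _)
          (sumFamilies-cong n₂′ λ χ → sym (sumMaps-*ˡ (B χ) _)))

      tail-separable : ∀ ξ i χ₀ → SeparableAt (n ∘ suc) i χ₀ (λ χ → K (∀-cons ξ χ))
      tail-separable ξ i χ₀ =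
        -- The fixed maps `χ₀` of the later parts are completed by `ξ` on the first part.
        let x , a , b , 0≤x , 0≤a , 0≤b , eq = K-sep (suc i) λ
              { zero _ → ξ ; (suc j) j≢i → χ₀ j (j≢i ∘ ≡.cong suc) }
        in x , a , b , 0≤x , 0≤a , 0≤b , λ χ χ≡ → eq (∀-cons ξ χ) λ
              { zero _ → ≡.refl ; (suc j) j≢i → χ≡ j _ }

      swapHead : ∀ χ → sumMaps (λ ξ → A₀ ξ * K (∀-cons ξ χ)) ≤ sumMaps (λ ξ → B₀ ξ * K (∀-cons ξ χ))
      swapHead χ =
        let x , a , b , 0≤x , 0≤a , 0≤b , eq = K-sep zero λ
              { zero 0≢0 → contradiction ≡.refl 0≢0 ; (suc j) _ → χ j }
            K≈ = λ ξ → eq (∀-cons ξ χ) λ { zero 0≢0 → contradiction ≡.refl 0≢0 ; (suc j) _ → ≡.refl }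
        in ≲-respˡ-≈ (sumMaps-cong λ ξ → *-congˡ (sym (K≈ ξ)))
             (≲-respʳ-≈ (sumMaps-cong λ ξ → *-congˡ (sym (K≈ ξ)))
               (swapPart H₀ (swaps zero) x a b 0≤x 0≤a 0≤b))

    blowUp-swapping : ∀ {k} (H : Graph) (parts : Fin k → Graph) (label : Vertex H ↔ Σ (Fin k) (Vertex ∘ parts))
      (adj : Fin k → Fin k → Bool) (side : Fin k → Fin 2) →
      (∀ x y → w x y ≈ w y x) →
      (∀ i u v → does (Graph.adj? H (from label (i , u)) (from label (i , v))) ≡ does (Graph.adj? (parts i) u v)) →
      (∀ i j u v → i ≢ j → does (Graph.adj? H (from label (i , u)) (from label (j , v))) ≡ adj i j) →
      (∀ i j → adj i j ≡ true → side i ≢ side j) →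
      (∀ i → CrossSwapping (parts i)) →
      sumMaps (edgeProduct H) * sumMaps (edgeProduct H) ≤ sumMaps (edgeProduct (H ×K₂))
    blowUp-swapping H parts label adj side w-sym within between bipartite swaps =
      ≲-respˡ-≈ (sym (hom² side bipartite)) (≲-respʳ-≈ (sym hom-×K₂)
        (swapAllParts parts swaps (interaction n adj) (interaction-cong n adj)
          (λ i χ₀ → separable-interaction n i χ₀ w-nonneg adj)))
      where open BlowUp w-sym H parts label adj within between

-- The ordered semiring of real numbers

open import Defs

private
  module _ where
    open +-*-Solver

    difference-+ : ∀ p q → q ℚ.+ (p ℚ.- q) ≡ p
    difference-+ = solve 2 (λ p q → q :+ (p :- q) := p) ≡.refl

    difference-of-products : ∀ p q r s → p ℚ.* q ℚ.- r ℚ.* s ≡ p ℚ.* (q ℚ.- s) ℚ.+ s ℚ.* (p ℚ.- r)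
    difference-of-products = solve 4 (λ p q r s → p :* q :- r :* s := p :* (q :- s) :+ s :* (p :- r)) ≡.refl

    +-interchange-δ : ∀ p q δ → (p ℚ.+ δ) ℚ.+ (q ℚ.+ δ) ≡ (p ℚ.+ q) ℚ.+ (δ ℚ.+ δ)
    +-interchange-δ = solve 3 (λ p q δ → (p :+ δ) :+ (q :+ δ) := (p :+ q) :+ (δ :+ δ)) ≡.refl

    factor : ∀ p q r → p ℚ.* q ℚ.- p ℚ.* r ≡ p ℚ.* (q ℚ.- r)
    factor = solve 3 (λ p q r → p :* q :- p :* r := p :* (q :- r)) ≡.refl

    neg-difference : ∀ p q → ℚ.- (p ℚ.- q) ≡ q ℚ.- p
    neg-difference = solve 2 (λ p q → :- (p :- q) := q :- p) ≡.refl

    cancel-sub : ∀ p ε → ε ℚ.+ p ℚ.- p ≡ ε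
    cancel-sub = solve 2 (λ p ε → ε :+ p :- p := ε) ≡.refl

p-q≤ε⇒p≤q+ε : ∀ p q {ε} → p ℚ.- q ℚ.≤ ε → p ℚ.≤ q ℚ.+ ε
p-q≤ε⇒p≤q+ε p q {ε} p-q≤ε = begin
  p                 ≡⟨ difference-+ p q ⟨
  q ℚ.+ (p ℚ.- q)   ≤⟨ ℚ.+-monoʳ-≤ q p-q≤ε ⟩
  q ℚ.+ ε           ∎
  where open ℚ.≤-Reasoning

p≤q+ε⇒p-q≤ε : ∀ p q {ε} → p ℚ.≤ q ℚ.+ ε → p ℚ.- q ℚ.≤ ε
p≤q+ε⇒p-q≤ε p q {ε} p≤q+ε = begin
  p ℚ.- q           ≤⟨ ℚ.+-monoˡ-≤ (ℚ.- q) p≤q+ε ⟩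
  q ℚ.+ ε ℚ.- q     ≡⟨ ≡.cong (ℚ._- q) (ℚ.+-comm q ε) ⟩
  ε ℚ.+ q ℚ.- q     ≡⟨ cancel-sub q ε ⟩
  ε                 ∎
  where open ℚ.≤-Reasoning

p≤∣p∣ : ∀ p → p ℚ.≤ ∣ p ∣
p≤∣p∣ p with ℚ.≤-total 0ℚ p
... | inj₁ 0≤p = ℚ.≤-reflexive (≡.sym (ℚ.0≤p⇒∣p∣≡p 0≤p))
... | inj₂ p≤0 = ℚ.≤-trans p≤0 (ℚ.0≤∣p∣ p)

∣p-q∣≡∣q-p∣ : ∀ p q → ∣ p ℚ.- q ∣ ≡ ∣ q ℚ.- p ∣
∣p-q∣≡∣q-p∣ p q = ≡.trans (≡.sym (ℚ.∣-p∣≡∣p∣ (p ℚ.- q))) (≡.cong ∣_∣ (neg-difference p q))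

≈-refl : ∀ {x} → x ≈ x
≈-refl {x} ε 0<ε = 0 , λ n _ → ℚ.≤-trans
  (ℚ.≤-reflexive (≡.cong ∣_∣ (ℚ.+-inverseʳ (seq x n)))) (ℚ.<⇒≤ 0<ε)

-- The source of the algebraic laws of `ℝ`, which hold term by term in `ℚ`.
≗⇒≈ : ∀ {x y} → (∀ n → seq x n ≡ seq y n) → x ≈ y
≗⇒≈ {x} {y} x≗y ε 0<ε = 0 , λ n _ → ≡.subst (λ q → ∣ seq x n ℚ.- q ∣ ℚ.≤ ε) (x≗y n)
  (proj₂ (≈-refl {x} ε 0<ε) n ℕ.z≤n)

≈-sym : ∀ {x y} → x ≈ y → y ≈ x
≈-sym {x} {y} x≈y ε 0<ε = let N , h = x≈y ε 0<ε in
  N , λ n N≤n → ≡.subst (ℚ._≤ ε) (∣p-q∣≡∣q-p∣ (seq x n) (seq y n)) (h n N≤n)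

≈⇒≤ : ∀ {x y} → x ≈ y → x ≤ y
≈⇒≤ {x} {y} x≈y ε 0<ε = let N , h = x≈y ε 0<ε in
  N , λ n N≤n → p-q≤ε⇒p≤q+ε (seq x n) (seq y n) (ℚ.≤-trans (p≤∣p∣ (seq x n ℚ.- seq y n)) (h n N≤n))

∣p-q∣≤ε : ∀ p q {ε} → p ℚ.≤ q ℚ.+ ε → q ℚ.≤ p ℚ.+ ε → ∣ p ℚ.- q ∣ ℚ.≤ ε
∣p-q∣≤ε p q {ε} p≤ q≤ with ℚ.∣p∣≡p∨∣p∣≡-p (p ℚ.- q)
... | inj₁ eq = ≡.subst (ℚ._≤ ε) (≡.sym eq) (p≤q+ε⇒p-q≤ε p q p≤)
... | inj₂ eq = ≡.subst (ℚ._≤ ε) (≡.sym (≡.trans eq (neg-difference p q))) (p≤q+ε⇒p-q≤ε q p q≤)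

≤-antisym : ∀ {x y} → x ≤ y → y ≤ x → x ≈ y
≤-antisym {x} {y} x≤y y≤x ε 0<ε =
  let M , hM = x≤y ε 0<ε
      N , hN = y≤x ε 0<ε
  in M ℕ.⊔ N , λ n n≥ → ∣p-q∣≤ε (seq x n) (seq y n)
       (hM n (ℕ.m⊔n≤o⇒m≤o M N n≥)) (hN n (ℕ.m⊔n≤o⇒n≤o M N n≥))

≤-trans : ∀ {x y z} → x ≤ y → y ≤ z → x ≤ z
≤-trans {x} {y} {z} x≤y y≤z ε 0<ε =
  let δ , 0<δ , eq = half-ε ε 0<ε
      M , hM = x≤y δ 0<δ
      N , hN = y≤z δ 0<δ
  in M ℕ.⊔ N , λ n n≥ → begin
    seq x n                   ≤⟨ hM n (ℕ.m⊔n≤o⇒m≤o M N n≥) ⟩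
    seq y n ℚ.+ δ             ≤⟨ ℚ.+-monoˡ-≤ δ (hN n (ℕ.m⊔n≤o⇒n≤o M N n≥)) ⟩
    (seq z n ℚ.+ δ) ℚ.+ δ     ≡⟨ ℚ.+-assoc (seq z n) δ δ ⟩
    seq z n ℚ.+ (δ ℚ.+ δ)     ≡⟨ ≡.cong (seq z n ℚ.+_) eq ⟩
    seq z n ℚ.+ ε             ∎
  where open ℚ.≤-Reasoning

-- Two one-sided estimates take the place of the triangle inequality.
≈-trans : ∀ {x y z} → x ≈ y → y ≈ z → x ≈ z
≈-trans {x} {y} {z} x≈y y≈z = ≤-antisym {x} {z}
  (≤-trans {x} {y} {z} (≈⇒≤ {x} {y} x≈y) (≈⇒≤ {y} {z} y≈z))
  (≤-trans {z} {y} {x} (≈⇒≤ {z} {y} (≈-sym {y} {z} y≈z)) (≈⇒≤ {y} {x} (≈-sym {x} {y} x≈y)))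

+-mono-≤ : ∀ {x y u v} → x ≤ y → u ≤ v → x + u ≤ y + v
+-mono-≤ {x} {y} {u} {v} x≤y u≤v ε 0<ε =
  let δ , 0<δ , eq = half-ε ε 0<ε
      M , hM = x≤y δ 0<δ
      N , hN = u≤v δ 0<δ
  in M ℕ.⊔ N , λ n n≥ → begin
    seq x n ℚ.+ seq u n
      ≤⟨ ℚ.+-mono-≤ (hM n (ℕ.m⊔n≤o⇒m≤o M N n≥)) (hN n (ℕ.m⊔n≤o⇒n≤o M N n≥)) ⟩
    (seq y n ℚ.+ δ) ℚ.+ (seq v n ℚ.+ δ)
      ≡⟨ +-interchange-δ (seq y n) (seq v n) δ ⟩
    (seq y n ℚ.+ seq v n) ℚ.+ (δ ℚ.+ δ)
      ≡⟨ ≡.cong (seq y n ℚ.+ seq v n ℚ.+_) eq ⟩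
    (seq y n ℚ.+ seq v n) ℚ.+ ε ∎
  where open ℚ.≤-Reasoning

+-cong : ∀ {x y u v} → x ≈ y → u ≈ v → x + u ≈ y + v
+-cong {x} {y} {u} {v} x≈y u≈v = ≤-antisym {x + u} {y + v}
  (+-mono-≤ {x} {y} {u} {v} (≈⇒≤ {x} {y} x≈y) (≈⇒≤ {u} {v} u≈v))
  (+-mono-≤ {y} {x} {v} {u} (≈⇒≤ {y} {x} (≈-sym {x} {y} x≈y)) (≈⇒≤ {v} {u} (≈-sym {u} {v} u≈v)))

-- The estimate rests on `xu - yv = x(u - v) + v(x - y)`, where `x` and `v` are eventually bounded.
*-cong : ∀ {x y u v} → x ≈ y → u ≈ v → x * u ≈ y * v
*-cong {x} {y} {u} {v} x≈y u≈v ε 0<ε =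
  let K , b , 0<b , x≤b = eventually-bounded (seq x) (cauchy x)
      L , d , 0<d , v≤d = eventually-bounded (seq v) (cauchy v)
      δ , 0<δ , eq = split-ε b d ε 0<b 0<d 0<ε
      M , hM = x≈y δ 0<δ
      N , hN = u≈v δ 0<δ
  in (K ℕ.⊔ L) ℕ.⊔ (M ℕ.⊔ N) , λ n n≥ →
    let KL≤n = ℕ.m⊔n≤o⇒m≤o (K ℕ.⊔ L) (M ℕ.⊔ N) n≥
        MN≤n = ℕ.m⊔n≤o⇒n≤o (K ℕ.⊔ L) (M ℕ.⊔ N) n≥
    in begin
      ∣ seq x n ℚ.* seq u n ℚ.- seq y n ℚ.* seq v n ∣
        ≡⟨ ≡.cong ∣_∣ (difference-of-products (seq x n) (seq u n) (seq y n) (seq v n)) ⟩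
      ∣ seq x n ℚ.* (seq u n ℚ.- seq v n) ℚ.+ seq v n ℚ.* (seq x n ℚ.- seq y n) ∣
        ≤⟨ ℚ.∣p+q∣≤∣p∣+∣q∣ (seq x n ℚ.* (seq u n ℚ.- seq v n)) (seq v n ℚ.* (seq x n ℚ.- seq y n)) ⟩
      ∣ seq x n ℚ.* (seq u n ℚ.- seq v n) ∣ ℚ.+ ∣ seq v n ℚ.* (seq x n ℚ.- seq y n) ∣
        ≤⟨ ℚ.+-mono-≤
             (*-mono-∣∣ (seq x n) (seq u n ℚ.- seq v n) b δ
               (x≤b n (ℕ.m⊔n≤o⇒m≤o K L KL≤n)) (hN n (ℕ.m⊔n≤o⇒n≤o M N MN≤n)) 0<b)
             (*-mono-∣∣ (seq v n) (seq x n ℚ.- seq y n) d δ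
               (v≤d n (ℕ.m⊔n≤o⇒n≤o K L KL≤n)) (hM n (ℕ.m⊔n≤o⇒m≤o M N MN≤n)) 0<d) ⟩
      b ℚ.* δ ℚ.+ d ℚ.* δ
        ≡⟨ eq ⟩
      ε ∎
  where open ℚ.≤-Reasoning

*-nonnegative : ∀ {b δ} → 0ℚ ℚ.< b → 0ℚ ℚ.< δ → 0ℚ ℚ.≤ b ℚ.* δ
*-nonnegative {b} {δ} 0<b 0<δ = ≡.subst (ℚ._≤ b ℚ.* δ) (ℚ.*-zeroʳ b)
  (ℚ.*-monoˡ-≤-nonNeg b {{ℚ.nonNegative (ℚ.<⇒≤ 0<b)}} (ℚ.<⇒≤ 0<δ))

-- If p ≥ 0 the product is at most pδ, otherwise it is at most ∣r∣δ.
*-almost-nonneg : ∀ p r b d δ → 0ℚ ℚ.< b → 0ℚ ℚ.< d → 0ℚ ℚ.< δ → ∣ p ∣ ℚ.≤ b → ∣ r ∣ ℚ.≤ d →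
  0ℚ ℚ.≤ p ℚ.+ δ → r ℚ.≤ δ → p ℚ.* r ℚ.≤ b ℚ.* δ ℚ.+ d ℚ.* δ
*-almost-nonneg p r b d δ 0<b 0<d 0<δ ∣p∣≤b ∣r∣≤d 0≤p+δ r≤δ with ℚ.≤-total 0ℚ p
... | inj₁ 0≤p = begin
  p ℚ.* r                ≤⟨ ℚ.*-monoˡ-≤-nonNeg p {{ℚ.nonNegative 0≤p}} r≤δ ⟩
  p ℚ.* δ                ≤⟨ ℚ.*-monoʳ-≤-nonNeg δ {{ℚ.nonNegative (ℚ.<⇒≤ 0<δ)}} (ℚ.≤-trans (p≤∣p∣ p) ∣p∣≤b) ⟩
  b ℚ.* δ                ≡⟨ ℚ.+-identityʳ (b ℚ.* δ) ⟨
  b ℚ.* δ ℚ.+ 0ℚ         ≤⟨ ℚ.+-monoʳ-≤ (b ℚ.* δ) (*-nonnegative 0<d 0<δ) ⟩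
  b ℚ.* δ ℚ.+ d ℚ.* δ    ∎
  where
  open ℚ.≤-Reasoning
... | inj₂ p≤0 = begin
  p ℚ.* r                ≤⟨ p≤∣p∣ (p ℚ.* r) ⟩
  ∣ p ℚ.* r ∣            ≡⟨ ≡.cong ∣_∣ (ℚ.*-comm p r) ⟩
  ∣ r ℚ.* p ∣            ≤⟨ *-mono-∣∣ r p d δ ∣r∣≤d ∣p∣≤δ 0<d ⟩
  d ℚ.* δ                ≡⟨ ℚ.+-identityˡ (d ℚ.* δ) ⟨
  0ℚ ℚ.+ d ℚ.* δ         ≤⟨ ℚ.+-monoˡ-≤ (d ℚ.* δ) (*-nonnegative 0<b 0<δ) ⟩
  b ℚ.* δ ℚ.+ d ℚ.* δ    ∎
  where
  open ℚ.≤-Reasoning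
  ∣p∣≤δ : ∣ p ∣ ℚ.≤ δ
  ∣p∣≤δ = ≡.subst (λ q → ∣ q ∣ ℚ.≤ δ) (ℚ.+-identityʳ p)
    (∣p-q∣≤ε p 0ℚ (ℚ.≤-trans p≤0 (ℚ.≤-trans (ℚ.<⇒≤ 0<δ) (ℚ.≤-reflexive (≡.sym (ℚ.+-identityˡ δ))))) 0≤p+δ)

-- `0ℝ ≤ x` still lets the terms of `x` be slightly negative, so termwise monotonicity can fail. The
-- failure is controlled by the size of `y - z`.
*-monoˡ-≤ : ∀ {x y z} → 0ℝ ≤ x → y ≤ z → x * y ≤ x * z
*-monoˡ-≤ {x} {y} {z} 0≤x y≤z ε 0<ε =
  let K , b , 0<b , x≤b = eventually-bounded (seq x) (cauchy x)
      L , c , 0<c , y≤c = eventually-bounded (seq y) (cauchy y)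
      L′ , c′ , 0<c′ , z≤c′ = eventually-bounded (seq z) (cauchy z)
      0<d = ℚ.+-mono-< 0<c 0<c′
      -- `b` bounds `x`, and `c + c′` bounds `y - z` by the triangle inequality.
      δ , 0<δ , eq = split-ε b (c ℚ.+ c′) ε 0<b 0<d 0<ε
      M , hM = 0≤x δ 0<δ
      N , hN = y≤z δ 0<δ
  in (K ℕ.⊔ (L ℕ.⊔ L′)) ℕ.⊔ (M ℕ.⊔ N) , λ n n≥ →
    let KL≤n = ℕ.m⊔n≤o⇒m≤o (K ℕ.⊔ (L ℕ.⊔ L′)) (M ℕ.⊔ N) n≥
        LL≤n = ℕ.m⊔n≤o⇒n≤o K (L ℕ.⊔ L′) KL≤n
        MN≤n = ℕ.m⊔n≤o⇒n≤o (K ℕ.⊔ (L ℕ.⊔ L′)) (M ℕ.⊔ N) n≥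
        xₙ = seq x n ; yₙ = seq y n ; zₙ = seq z n
    in p-q≤ε⇒p≤q+ε (xₙ ℚ.* yₙ) (xₙ ℚ.* zₙ) (begin
      xₙ ℚ.* yₙ ℚ.- xₙ ℚ.* zₙ
        ≡⟨ factor xₙ yₙ zₙ ⟩
      xₙ ℚ.* (yₙ ℚ.- zₙ)
        ≤⟨ *-almost-nonneg xₙ (yₙ ℚ.- zₙ) b (c ℚ.+ c′) δ 0<b 0<d 0<δ
             (x≤b n (ℕ.m⊔n≤o⇒m≤o K (L ℕ.⊔ L′) KL≤n))
             (ℚ.≤-trans (ℚ.∣p-q∣≤∣p∣+∣q∣ yₙ zₙ)
               (ℚ.+-mono-≤ (y≤c n (ℕ.m⊔n≤o⇒m≤o L L′ LL≤n)) (z≤c′ n (ℕ.m⊔n≤o⇒n≤o L L′ LL≤n))))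
             (hM n (ℕ.m⊔n≤o⇒m≤o M N MN≤n))
             (p≤q+ε⇒p-q≤ε yₙ zₙ (hN n (ℕ.m⊔n≤o⇒n≤o M N MN≤n))) ⟩
      b ℚ.* δ ℚ.+ (c ℚ.+ c′) ℚ.* δ
        ≡⟨ eq ⟩
      ε ∎)
  where open ℚ.≤-Reasoning

0≤1 : 0ℝ ≤ 1ℝ
0≤1 ε 0<ε = 0 , λ _ _ → ℚ.≤-trans (ℚ.nonNegative⁻¹ 1ℚ) (ℚ.≤-trans
  (ℚ.≤-reflexive (≡.sym (ℚ.+-identityʳ 1ℚ))) (ℚ.+-monoʳ-≤ 1ℚ (ℚ.<⇒≤ 0<ε)))

ℝ-commutativeSemiring : CommutativeSemiring 0ℓ 0ℓ
ℝ-commutativeSemiring = record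
  { Carrier = ℝ ; _≈_ = _≈_ ; _+_ = _+_ ; _*_ = _*_ ; 0# = 0ℝ ; 1# = 1ℝ
  ; isCommutativeSemiring = record
    { isSemiring = record
      { isSemiringWithoutAnnihilatingZero = record
        { +-isCommutativeMonoid = record
          { isMonoid = record
            { isSemigroup = record
              { isMagma = record
                { isEquivalence = record
                  { refl  = λ {x} → ≈-refl {x}
                  ; sym   = λ {x} {y} → ≈-sym {x} {y}
                  ; trans = λ {x} {y} {z} → ≈-trans {x} {y} {z} }
                ; ∙-cong = λ {x} {y} {u} {v} → +-cong {x} {y} {u} {v} }
              ; assoc = λ x y z → ≗⇒≈ {(x + y) + z} {x + (y + z)} λ n → ℚ.+-assoc (seq x n) (seq y n) (seq z n) }
            ; identity = (λ x → ≗⇒≈ {0ℝ + x} {x} λ n → ℚ.+-identityˡ (seq x n))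
                       , (λ x → ≗⇒≈ {x + 0ℝ} {x} λ n → ℚ.+-identityʳ (seq x n)) }
          ; comm = λ x y → ≗⇒≈ {x + y} {y + x} λ n → ℚ.+-comm (seq x n) (seq y n) }
        ; *-cong = λ {x} {y} {u} {v} → *-cong {x} {y} {u} {v}
        ; *-assoc = λ x y z → ≗⇒≈ {(x * y) * z} {x * (y * z)} λ n → ℚ.*-assoc (seq x n) (seq y n) (seq z n)
        ; *-identity = (λ x → ≗⇒≈ {1ℝ * x} {x} λ n → ℚ.*-identityˡ (seq x n))
                     , (λ x → ≗⇒≈ {x * 1ℝ} {x} λ n → ℚ.*-identityʳ (seq x n))
        ; distrib = (λ x y z → ≗⇒≈ {x * (y + z)} {x * y + x * z} λ n → ℚ.*-distribˡ-+ (seq x n) (seq y n) (seq z n))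
                  , (λ x y z → ≗⇒≈ {(y + z) * x} {y * x + z * x} λ n → ℚ.*-distribʳ-+ (seq x n) (seq y n) (seq z n)) }
      ; zero = (λ x → ≗⇒≈ {0ℝ * x} {0ℝ} λ n → ℚ.*-zeroˡ (seq x n))
             , (λ x → ≗⇒≈ {x * 0ℝ} {0ℝ} λ n → ℚ.*-zeroʳ (seq x n)) }
    ; *-comm = λ x y → ≗⇒≈ {x * y} {y * x} λ n → ℚ.*-comm (seq x n) (seq y n) } }

ℝ-orderedCommutativeSemiring : OrderedCommutativeSemiring 0ℓ 0ℓ 0ℓ
ℝ-orderedCommutativeSemiring = record
  { commutativeSemiring = ℝ-commutativeSemiring
  ; _≤_ = _≤_
  ; ≤-isPreorder = record
    { isEquivalence = CommutativeSemiring.isEquivalence ℝ-commutativeSemiring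
    ; reflexive = λ {x} {y} → ≈⇒≤ {x} {y}
    ; trans = λ {x} {y} {z} → ≤-trans {x} {y} {z} }
  ; +-mono-≤ = λ {x} {y} {u} {v} → +-mono-≤ {x} {y} {u} {v}
  ; *-monoˡ-≤ = λ {x} {y} {z} → *-monoˡ-≤ {x} {y} {z}
  ; 0≤1 = 0≤1 }

-- Adjacency in a blow-up, and the theorem over the reals

adjacent-label : ∀ {𝓗 F H} (B : IsBlowUp 𝓗 F H) → let open IsBlowUp B in
  ∀ p q → Graph.Adj H (from label p) (from label q) ⇔ BlowUpAdj F parts p q
adjacent-label {F = F} {H} B p q = ≡.subst₂
  (λ p′ q′ → Graph.Adj H (from label p) (from label q) ⇔ BlowUpAdj F parts p′ q′)
  (strictlyInverseˡ label p) (strictlyInverseˡ label q) (adj⇔ (from label p) (from label q))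
  where open IsBlowUp B

adjacent-within : ∀ {𝓗 F H} (B : IsBlowUp 𝓗 F H) → let open IsBlowUp B in
  ∀ i u v → Graph.Adj H (from label (i , u)) (from label (i , v)) ⇔ Graph.Adj (parts i) u v
adjacent-within {F = F} B i u v =
  mk⇔ (λ uv → go (Equivalence.to (adjacent-label B (i , u) (i , v)) uv))
      (λ uv → Equivalence.from (adjacent-label B (i , u) (i , v)) (within uv))
  where
  open IsBlowUp B
  go : BlowUpAdj F parts (i , u) (i , v) → Graph.Adj (parts i) u v
  go (within uv)  = uv
  -- `between` could act inside a part only through a loop of `F`.
  go (between ii) = contradiction ii (Graph.irrefl F ≡.refl)

adjacent-between : ∀ {𝓗 F H} (B : IsBlowUp 𝓗 F H) → let open IsBlowUp B in
  ∀ i j u v → i ≢ j → Graph.Adj H (from label (i , u)) (from label (j , v)) ⇔ Graph.Adj F i j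
adjacent-between {F = F} B i j u v i≢j =
  mk⇔ (λ uv → go (Equivalence.to (adjacent-label B (i , u) (j , v)) uv))
      (λ ij → Equivalence.from (adjacent-label B (i , u) (j , v)) (between ij))
  where
  open IsBlowUp B
  go : BlowUpAdj F parts (i , u) (j , v) → Graph.Adj F i j
  go (within _)   = contradiction ≡.refl i≢j
  go (between ij) = ij

opaque
  unfolding MapSums.sumMaps

  theorem5p4 : (G : WeightedGraph) (F : Graph) → Bipartite F →
    (H : Graph) → IsBlowUp (WeightedCrossBipartiteSwapping G) F H →
    BipartiteSwapping G H
  theorem5p4 G F (side , bipartite) H B =
    blowUp-swapping nonneg H parts label (λ i j → does (Graph.adj? F i j)) side symm
      (λ i u v → does-⇔ (adjacent-within B i u v) (Graph.adj? H _ _) (Graph.adj? (parts i) u v))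
      (λ i j u v i≢j → does-⇔ (adjacent-between B i j u v i≢j) (Graph.adj? H _ _) (Graph.adj? F i j))
      (λ i j ij → bipartite (does-true (Graph.adj? F i j) ij))
      -- With `sumMaps` unfolded, `CrossSwapping` over the reals is `WeightedCrossBipartiteSwapping`
      -- by definition.
      parts∈𝓗
    where
    open WeightedGraph G
    open IsBlowUp B
    open Swapping ℝ-orderedCommutativeSemiring weight
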